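{- Let $d\geq 2$ be an integer, let $e_1,\dots,e_d$ be the standard basis of $\mathbb{Z}^d$, let $U=\{\pm e_i : i=1,\dots,d\}\cup\{\pm 2e_1\}$, and let $\mathbb{Z}^d_U$ be the undirected Cayley graph on $\mathbb{Z}^d$ with generating set $U$. Then the edge isoperimetric problem for $\mathbb{Z}^d_U$ does not have nested solutions starting at any size. In other words: for every $n\in\mathbb{N}$ and every $n$-element subset $S_n$ of $\mathbb{Z}^d$ for which $\partial(S_n)$ is the minimum of $\partial$ among all $n$-element subsets of $\mathbb{Z}^d$, there does not exist an infinite sequence $S_n\subset S_{n+1}\subset S_{n+2}\subset\cdots$ of subsets of $\mathbb{Z}^d$ with $|S_i|=i$ for all $i\geq n$ such that, for each $i\geq n$, $\partial(S_i)$ is the minimum of $\partial$ among all $i$-element subsets of $\mathbb{Z}^d$.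
   Context: For a finite symmetric set $U\subset\mathbb{Z}^d\setminus\{0\}$ that generates $\mathbb{Z}^d$ as a group, $\mathbb{Z}^d_U$ denotes the undirected graph with vertex set $\mathbb{Z}^d$ in which $x$ and $y$ are joined by an edge if and only if $y-x\in U$. For a graph $G$ and $S\subseteq V(G)$, the edge boundary is the number $\partial(S)=|\{uv\in E(G): u\in S,\ v\notin S\}|$; here it is taken with respect to $G=\mathbb{Z}^d_U$. -}

module Defs where

open import Algebra.Bundles using (module AbelianGroup)
import Algebra.Properties.Group as Group
open import Data.Fin.Base using (Fin; zero; suc)
open import Data.Integer.Base as ℤ using (ℤ; 0ℤ; 1ℤ)
import Data.Integer.Properties as ℤ
open import Data.List.Base using (List; []; _∷_; _++_; map; length; filter; allFin; cartesianProductWith)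
open import Data.List.Membership.Propositional using (_∈_; _∉_)
open import Data.List.Membership.Propositional.Properties
  using (∈-map⁺; ∈-map⁻; ∈-++⁺ˡ; ∈-++⁺ʳ; ∈-++⁻; ∈-filter⁺; ∈-filter⁻; ∈-cartesianProductWith⁺; ∈-cartesianProductWith⁻)
open import Data.List.Relation.Binary.BagAndSetEquality using (_∼[_]_; set)
open import Data.List.Relation.Binary.Subset.Propositional using (_⊆_)
import Data.List.Relation.Unary.All as All
open import Data.List.Relation.Unary.AllPairs using (_∷_)
open import Data.List.Relation.Unary.Any using (here; there)
open import Data.List.Relation.Unary.Unique.Propositional using (Unique)
import Data.List.Relation.Unary.Unique.Propositional.Properties as Unique
open import Data.Nat.Base using (ℕ; zero; suc; _≤_; z≤n; s≤s)
open import Data.Product.Base using (Σ-syntax; _×_; _,_; proj₁; proj₂)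
open import Data.Sum.Base using (inj₁; inj₂)
open import Data.Vec.Base as Vec using (Vec; []; _∷_; replicate; zipWith; _[_]≔_)
open import Data.Vec.Properties using (≡-dec)
open import Function.Bundles using (_⇔_; mk⇔)
open import Relation.Binary.Definitions using (DecidableEquality)
open import Relation.Binary.PropositionalEquality
  using (_≡_; refl; sym; trans; cong; cong₂; subst)
open import Relation.Nullary using (¬_; ¬?)

ℤ^_ : ℕ → Set
ℤ^ d = Vec ℤ d

infix 10 ℤ^_
infixl 6 _⊹_ _⊖_
infix 8 ⊝_
infixr 7 _·_

_≟_ : ∀ {d} → DecidableEquality (ℤ^ d)
_≟_ = ≡-dec ℤ._≟_

_⊹_ _⊖_ : ∀ {d} → ℤ^ d → ℤ^ d → ℤ^ d
_⊹_ = zipWith ℤ._+_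
_⊖_ = zipWith ℤ._-_

⊝_ : ∀ {d} → ℤ^ d → ℤ^ d
⊝_ = Vec.map (λ a → ℤ.- a)

_·_ : ∀ {d} → ℤ → ℤ^ d → ℤ^ d
k · x = Vec.map (λ a → k ℤ.* a) x

e : ∀ {d} → Fin d → ℤ^ d
e i = replicate _ 0ℤ [ i ]≔ 1ℤ

-- A finite set is a list without repetitions, taken up to _∼[ set ]_.
HasSize : ∀ {d} → ℕ → List (ℤ^ d) → Set
HasSize n S = Unique S × length S ≡ n

module Cayley {d : ℕ} (U : List (ℤ^ d)) where

  open import Data.List.Membership.DecPropositional (_≟_ {d}) using (_∈?_)

  Adjacent : ℤ^ d → ℤ^ d → Set
  Adjacent x y = (y ⊖ x) ∈ U

  -- An undirected edge with exactly one endpoint in S is listed once, as the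
  -- ordered pair (u , v) with u ∈ S and v ∉ S; see edgeBoundary-unique and
  -- ∈-edgeBoundary below.
  edgeBoundary : List (ℤ^ d) → List (ℤ^ d × ℤ^ d)
  edgeBoundary S = filter (λ (_ , v) → ¬? (v ∈? S))
                          (cartesianProductWith (λ u g → u , u ⊹ g) S U)

  ∂ : List (ℤ^ d) → ℕ
  ∂ S = length (edgeBoundary S)

  IsOptimal : ℕ → List (ℤ^ d) → Set
  IsOptimal n S = HasSize n S × (∀ T → HasSize n T → ∂ S ≤ ∂ T)

  -- The values of the sequence at indices below n are irrelevant.
  NestedSolutionsFrom : ℕ → List (ℤ^ d) → Set
  NestedSolutionsFrom n Sₙ =
    Σ[ S ∈ (ℕ → List (ℤ^ d)) ]
      (S n ∼[ set ] Sₙ) ×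
      (∀ i → n ≤ i → S i ⊆ S (suc i)) ×
      (∀ i → n ≤ i → IsOptimal i (S i))

-- Index 0 of Fin d is the first coordinate.
first : ∀ {d} → 2 ≤ d → Fin d
first (s≤s _) = zero

halfGenerators : ∀ {d} → 2 ≤ d → List (ℤ^ d)
halfGenerators {d} 2≤d = ℤ.+ 2 · e (first 2≤d) ∷ map e (allFin d)

generators : ∀ {d} → 2 ≤ d → List (ℤ^ d)
generators 2≤d = halfGenerators 2≤d ++ map ⊝_ (halfGenerators 2≤d)

private
  open Group (AbelianGroup.group ℤ.+-0-abelianGroup) using (∙-cancelˡ)

  j+[i-j] : ∀ i j → j ℤ.+ (i ℤ.- j) ≡ i
  j+[i-j] i j = trans (ℤ.+-comm j _) (trans (ℤ.+-assoc i (ℤ.- j) j)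
    (trans (cong (λ z → i ℤ.+ z) (ℤ.+-inverseˡ j)) (ℤ.+-identityʳ i)))

  x⊹[y⊖x] : ∀ {d} (x y : ℤ^ d) → x ⊹ (y ⊖ x) ≡ y
  x⊹[y⊖x] []       []       = refl
  x⊹[y⊖x] (a ∷ x) (b ∷ y) = cong₂ _∷_ (j+[i-j] b a) (x⊹[y⊖x] x y)

  ⊹-cancelˡ : ∀ {d} (x : ℤ^ d) {g h} → x ⊹ g ≡ x ⊹ h → g ≡ h
  ⊹-cancelˡ []      {[]}    {[]}    _  = refl
  ⊹-cancelˡ (a ∷ x) {b ∷ g} {c ∷ h} eq =
    cong₂ _∷_ (∙-cancelˡ a b c (cong Vec.head eq)) (⊹-cancelˡ x (cong Vec.tail eq))

  [x⊹g]⊖x : ∀ {d} (x g : ℤ^ d) → (x ⊹ g) ⊖ x ≡ g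
  [x⊹g]⊖x x g = ⊹-cancelˡ x (x⊹[y⊖x] x (x ⊹ g))

  ⊝-involutive : ∀ {d} (x : ℤ^ d) → ⊝ ⊝ x ≡ x
  ⊝-involutive []      = refl
  ⊝-involutive (a ∷ x) = cong₂ _∷_ (ℤ.neg-involutive a) (⊝-involutive x)

  ⊝-injective : ∀ {d} {x y : ℤ^ d} → ⊝ x ≡ ⊝ y → x ≡ y
  ⊝-injective {x = x} {y} eq =
    trans (sym (⊝-involutive x)) (trans (cong ⊝_ eq) (⊝-involutive y))

  total : ∀ {d} → ℤ^ d → ℤ
  total []      = 0ℤ
  total (a ∷ x) = a ℤ.+ total x

  total-0 : ∀ d → total (replicate d 0ℤ) ≡ 0ℤ
  total-0 zero    = refl
  total-0 (suc d) = trans (ℤ.+-identityˡ _) (total-0 d)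

  total-e : ∀ {d} (i : Fin d) → total (e i) ≡ 1ℤ
  total-e {suc d} zero    = cong (λ z → 1ℤ ℤ.+ z) (total-0 d)
  total-e         (suc i) = trans (ℤ.+-identityˡ _) (total-e i)

  total-⊝ : ∀ {d} (x : ℤ^ d) → total (⊝ x) ≡ ℤ.- total x
  total-⊝ []      = refl
  total-⊝ (a ∷ x) = trans (cong (λ z → ℤ.- a ℤ.+ z) (total-⊝ x))
                          (sym (ℤ.neg-distrib-+ a (total x)))

  total-· : ∀ {d} k (x : ℤ^ d) → total (k · x) ≡ k ℤ.* total x
  total-· k []      = sym (ℤ.*-zeroʳ k)
  total-· k (a ∷ x) = trans (cong (λ z → k ℤ.* a ℤ.+ z) (total-· k x))
                            (sym (ℤ.*-distribˡ-+ k a (total x)))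

  total-2e : ∀ {d} (i : Fin d) → total (ℤ.+ 2 · e i) ≡ ℤ.+ 2
  total-2e i = trans (total-· (ℤ.+ 2) (e i)) (cong (λ z → ℤ.+ 2 ℤ.* z) (total-e i))

  e-injective : ∀ {d} {i j : Fin d} → e i ≡ e j → i ≡ j
  e-injective {i = zero}  {zero}  _  = refl
  e-injective {i = zero}  {suc j} ()
  e-injective {i = suc i} {zero}  ()
  e-injective {i = suc i} {suc j} eq = cong suc (e-injective (cong Vec.tail eq))

  half-positive : ∀ {d} (2≤d : 2 ≤ d) {g} → g ∈ halfGenerators 2≤d → 0ℤ ℤ.< total g
  half-positive 2≤d (here refl) rewrite total-2e (first 2≤d) = ℤ.+<+ (s≤s z≤n)
  half-positive 2≤d (there g∈) with i , _ , refl ← ∈-map⁻ e g∈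
    rewrite total-e i = ℤ.+<+ (s≤s z≤n)

  half-unique : ∀ {d} (2≤d : 2 ≤ d) → Unique (halfGenerators 2≤d)
  half-unique {d} 2≤d = All.tabulate 2e∉ ∷ Unique.map⁺ e-injective (Unique.allFin⁺ d)
    where
    2e∉ : ∀ {g} → g ∈ map e (allFin d) → ¬ (ℤ.+ 2 · e (first 2≤d) ≡ g)
    2e∉ g∈ eq with i , _ , refl ← ∈-map⁻ e g∈
      with () ← trans (sym (total-2e (first 2≤d))) (trans (cong total eq) (total-e i))

generators-unique : ∀ {d} (2≤d : 2 ≤ d) → Unique (generators 2≤d)
generators-unique 2≤d = Unique.++⁺ (half-unique 2≤d) (Unique.map⁺ ⊝-injective (half-unique 2≤d)) disjoint
  where
  disjoint : ∀ {g} → ¬ (g ∈ halfGenerators 2≤d × g ∈ map ⊝_ (halfGenerators 2≤d))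
  disjoint (g∈ , -g∈) with h , h∈ , refl ← ∈-map⁻ ⊝_ -g∈ =
    ℤ.<-asym (half-positive 2≤d h∈)
      (subst (λ z → z ℤ.< 0ℤ) (trans (cong (λ z → ℤ.- z) (total-⊝ h)) (ℤ.neg-involutive _))
        (ℤ.neg-mono-< (half-positive 2≤d g∈)))

generators-symmetric : ∀ {d} (2≤d : 2 ≤ d) {g} → g ∈ generators 2≤d → (⊝ g) ∈ generators 2≤d
generators-symmetric 2≤d g∈ with ∈-++⁻ (halfGenerators 2≤d) g∈
... | inj₁ g∈⁺ = ∈-++⁺ʳ (halfGenerators 2≤d) (∈-map⁺ ⊝_ g∈⁺)
... | inj₂ g∈⁻ with h , h∈ , refl ← ∈-map⁻ ⊝_ g∈⁻ =
  ∈-++⁺ˡ (subst (_∈ halfGenerators 2≤d) (sym (⊝-involutive h)) h∈)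

module _ {d : ℕ} (U S : List (ℤ^ d)) where
  open Cayley U
  open import Data.List.Membership.DecPropositional (_≟_ {d}) using (_∈?_)

  edgeBoundary-unique : Unique U → Unique S → Unique (edgeBoundary S)
  edgeBoundary-unique U! S! = Unique.filter⁺ _
    (Unique.cartesianProductWith⁺ _ injective S! U!)
    where
    injective : ∀ {u g u′ g′ : ℤ^ d} → (u , u ⊹ g) ≡ (u′ , u′ ⊹ g′) → u ≡ u′ × g ≡ g′
    injective {u} eq with refl ← cong proj₁ eq = refl , ⊹-cancelˡ u (cong proj₂ eq)

  ∈-edgeBoundary : ∀ {u v} → (u , v) ∈ edgeBoundary S ⇔ (u ∈ S × v ∉ S × Adjacent u v)
  ∈-edgeBoundary {u} {v} = mk⇔ to from
    where
    to : (u , v) ∈ edgeBoundary S → u ∈ S × v ∉ S × Adjacent u v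
    to p with q , v∉S ← ∈-filter⁻ (λ (_ , v) → ¬? (v ∈? S)) p
      with _ , g , u∈S , g∈U , refl ← ∈-cartesianProductWith⁻ (λ u g → u , u ⊹ g) S U q =
      u∈S , v∉S , subst (_∈ U) (sym ([x⊹g]⊖x u g)) g∈U

    from : u ∈ S × v ∉ S × Adjacent u v → (u , v) ∈ edgeBoundary S
    from (u∈S , v∉S , v-u∈U) = ∈-filter⁺ _
      (subst (λ w → (u , w) ∈ cartesianProductWith (λ u g → u , u ⊹ g) S U) (x⊹[y⊖x] u v)
        (∈-cartesianProductWith⁺ _ u∈S v-u∈U)) v∉S

{-# OPTIONS --safe #-}
-- Counting boundary edges line by line, the half-cost of a finite set S is at
-- least 3 M + Σ_t b(S_t) (up to a correction for lines with a single point),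
-- where S_t are the slices orthogonal to e₁, M is the number of lines in
-- direction e₁ meeting S, and b is the sum of the sizes of the coordinate
-- projections.  Let A ≥ 1, B = A + 1 and D = d − 1.  For a multiset c of D + 1
-- numbers A or B, with product Π and elementary symmetric polynomial E = e_D(c),
-- every T ⊂ ℤ^D satisfies the integral "tangent" inequality
--     |T| E ≤ b(T) Π + |T|²,
-- with equality for the boxes obtained from c by dropping one side.  Summing it
-- over the slices gives  n E + (3 Π − n) M ≤ (half-cost) Π.  The sign of 3 Π − n
-- bounds M from above or below, and boxes make this sharp: for large A,
--   * n = (3A + 2) A^D, c = (A^D , B) forces M ≤ A^D, so S has at least 3A + 2
--     nonempty slices;
--   * n = (3A + 1) B A^(D−1), c = (A^D , B) and c = (A^(D−1) , B , B) force
--     M = B A^(D−1) and all slices full, so S has at most 3A + 1 of them.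
-- Nested optimal sets at these two sizes would contradict each other.

module Submission where

open import Defs
open import Data.Fin.Base using (Fin; zero; suc)
open import Data.Integer.Base as ℤ using (ℤ; 0ℤ; 1ℤ)
import Data.Integer.Properties as ℤ
open import Data.List.Base
  using (List; []; _∷_; _++_; map; length; filter; deduplicate; tabulate; allFin; upTo; cartesianProductWith)
import Data.List.Membership.DecPropositional as DecMembership
open import Data.List.Membership.Propositional using (_∈_; _∉_)
open import Data.List.Membership.Propositional.Properties
  using (∈-map⁺; ∈-map⁻; ∈-filter⁺; ∈-filter⁻; ∈-deduplicate⁺; ∈-deduplicate⁻; ∈-∃++; ∈-length;
         ∈-cartesianProductWith⁺; ∈-upTo⁺; ∈-upTo⁻)
open import Data.List.Properties using (map-++; map-tabulate; length-map; length-tabulate; length-upTo)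
open import Data.List.Relation.Binary.Permutation.Propositional using (_↭_; ↭-sym; ↭⇒↭ₛ)
open import Data.List.Relation.Binary.Permutation.Propositional.Properties as ↭ using (↭-length; shift; ∈-resp-↭)
import Data.List.Relation.Binary.Permutation.Setoid.Properties as ↭ₛ
open import Data.List.Relation.Binary.Subset.Propositional using (_⊆_)
open import Data.List.Relation.Unary.All as All using (All; []; _∷_)
import Data.List.Relation.Unary.All.Properties as All
open import Data.List.Relation.Unary.AllPairs using ([]; _∷_)
open import Data.List.Relation.Unary.Any using (Any; here; there)
open import Data.List.Relation.Unary.Unique.DecPropositional.Properties using (deduplicate-!)
open import Data.List.Relation.Unary.Unique.Propositional using (Unique)
import Data.List.Relation.Unary.Unique.Propositional.Properties as Unique
open import Data.Nat.Base
open import Data.Nat.ListAction using (sum)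
open import Data.Nat.ListAction.Properties using (sum-++; sum-↭)
open import Data.Nat.Properties hiding (_≟_)
open import Data.Nat.Tactic.RingSolver using (solve-∀)
open import Data.Product.Base using (Σ-syntax; ∃-syntax; _×_; _,_; proj₁; proj₂)
open import Data.Sum.Base as Sum using (_⊎_; inj₁; inj₂)
open import Data.Unit.Base using (⊤; tt)
open import Data.Vec.Base as Vec using (Vec; []; _∷_; lookup; replicate; _[_]≔_)
open import Data.Vec.Properties
  using (lookup∘update; lookup∘update′; lookup-zipWith; zipWith-identityʳ; map-replicate)
open import Function.Base using (_∘_)
open import Relation.Binary.Definitions using (DecidableEquality)
open import Relation.Binary.PropositionalEquality
  using (_≡_; _≢_; refl; sym; trans; cong; cong₂; subst; subst₂; setoid; module ≡-Reasoning)
open import Relation.Nullary using (Dec; yes; no; ¬_; ¬?; contradiction)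
open import Relation.Unary using (Decidable)

-- Sums over lists and counting by injections

private variable
  X Y Z : Set

∑ : ∀ {a} {A : Set a} → (A → ℕ) → List A → ℕ
∑ f xs = sum (map f xs)

∑-mono : ∀ {f g : X → ℕ} xs → (∀ {x} → x ∈ xs → f x ≤ g x) → ∑ f xs ≤ ∑ g xs
∑-mono []       le = z≤n
∑-mono (x ∷ xs) le = +-mono-≤ (le (here refl)) (∑-mono xs (le ∘ there))

∑-cong : ∀ {f g : X → ℕ} xs → (∀ {x} → x ∈ xs → f x ≡ g x) → ∑ f xs ≡ ∑ g xs
∑-cong []       eq = refl
∑-cong (x ∷ xs) eq = cong₂ _+_ (eq (here refl)) (∑-cong xs (eq ∘ there))

∑-+ : ∀ (f g : X → ℕ) xs → ∑ (λ x → f x + g x) xs ≡ ∑ f xs + ∑ g xs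
∑-+ f g []       = refl
∑-+ f g (x ∷ xs) rewrite ∑-+ f g xs = eq (f x) (g x) (∑ f xs) (∑ g xs)
  where
  eq : ∀ a b c d → a + b + (c + d) ≡ a + c + (b + d)
  eq = solve-∀

∑-const : ∀ c (xs : List X) → ∑ (λ _ → c) xs ≡ length xs * c
∑-const c []       = refl
∑-const c (x ∷ xs) = cong (c +_) (∑-const c xs)

∑-one : ∀ (xs : List X) → ∑ (λ _ → 1) xs ≡ length xs
∑-one xs = trans (∑-const 1 xs) (*-identityʳ (length xs))

∑-swap : ∀ (f : X → Y → ℕ) xs ys → ∑ (λ x → ∑ (f x) ys) xs ≡ ∑ (λ y → ∑ (λ x → f x y) xs) ys
∑-swap f []       ys = sym (trans (∑-const 0 ys) (*-zeroʳ (length ys)))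
∑-swap f (x ∷ xs) ys rewrite ∑-swap f xs ys = sym (∑-+ (f x) _ ys)

∑-map : ∀ (f : Y → ℕ) (g : X → Y) xs → ∑ f (map g xs) ≡ ∑ (f ∘ g) xs
∑-map f g []       = refl
∑-map f g (x ∷ xs) = cong (f (g x) +_) (∑-map f g xs)

∑-↭ : ∀ (f : X → ℕ) {xs ys} → xs ↭ ys → ∑ f xs ≡ ∑ f ys
∑-↭ f xs↭ys = sum-↭ (↭.map⁺ f xs↭ys)

*-∑ : ∀ c (f : X → ℕ) xs → c * ∑ f xs ≡ ∑ (λ x → c * f x) xs
*-∑ c f []       = *-zeroʳ c
*-∑ c f (x ∷ xs) = trans (*-distribˡ-+ c (f x) _) (cong (c * f x +_) (*-∑ c f xs))

𝟙 : ∀ {P : Set} → Dec P → ℕ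
𝟙 (yes _) = 1
𝟙 (no  _) = 0

∑-filter : ∀ {P : X → Set} (P? : Decidable P) (f : X → ℕ) xs → ∑ f (filter P? xs) ≡ ∑ (λ x → 𝟙 (P? x) * f x) xs
∑-filter P? f []       = refl
∑-filter P? f (x ∷ xs) with P? x
... | yes _ = cong₂ _+_ (sym (+-identityʳ (f x))) (∑-filter P? f xs)
... | no  _ = ∑-filter P? f xs

length-filter-𝟙 : ∀ {P : X → Set} (P? : Decidable P) xs → length (filter P? xs) ≡ ∑ (𝟙 ∘ P?) xs
length-filter-𝟙 P? xs = trans (sym (∑-one (filter P? xs)))
  (trans (∑-filter P? (λ _ → 1) xs) (∑-cong xs (λ {x} _ → *-identityʳ (𝟙 (P? x)))))

extract : ∀ {x : X} {xs} → x ∈ xs → ∃[ xs′ ] xs ↭ x ∷ xs′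
extract {x = x} x∈xs with ys , zs , refl ← ∈-∃++ x∈xs = ys ++ zs , shift x ys zs

Unique-resp-↭ : ∀ {xs ys : List X} → xs ↭ ys → Unique xs → Unique ys
Unique-resp-↭ p = ↭ₛ.Unique-resp-↭ (setoid _) (↭⇒↭ₛ p)

-- Pigeonhole by induction on `xs`: one occurrence of `φ x` is taken out of `ys`, and injectivity
-- leaves the images of the remaining elements in the rest.
length-injection : ∀ (φ : X → Y) {xs ys} → Unique xs →
  (∀ {x x′} → x ∈ xs → x′ ∈ xs → φ x ≡ φ x′ → x ≡ x′) →
  (∀ {x} → x ∈ xs → φ x ∈ ys) → length xs ≤ length ys
length-injection φ {[]}     _              _   _    = z≤n
length-injection φ {x ∷ xs} {ys} (x∉ ∷ xs!) inj into
  with ys′ , p ← extract (into (here refl)) = begin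
  suc (length xs)  ≤⟨ s≤s (length-injection φ xs! (λ a b → inj (there a) (there b)) into′) ⟩
  suc (length ys′) ≡⟨ ↭-length p ⟨
  length ys        ∎
  where
  open ≤-Reasoning
  into′ : ∀ {z} → z ∈ xs → φ z ∈ ys′
  into′ z∈ with ∈-resp-↭ p (into (there z∈))
  ... | here φz≡φx = contradiction (sym (inj (there z∈) (here refl) φz≡φx)) (All.lookup x∉ z∈)
  ... | there φz∈  = φz∈

length-⊆ : ∀ {xs ys : List X} → Unique xs → (∀ {x} → x ∈ xs → x ∈ ys) → length xs ≤ length ys
length-⊆ xs! = length-injection (λ x → x) xs! (λ _ _ eq → eq)

∑-++ : ∀ (f : X → ℕ) xs ys → ∑ f (xs ++ ys) ≡ ∑ f xs + ∑ f ys
∑-++ f xs ys rewrite map-++ f xs ys = sum-++ (map f xs) (map f ys)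

∑-cartesianProductWith : ∀ (h : Z → ℕ) (f : X → Y → Z) xs ys →
  ∑ h (cartesianProductWith f xs ys) ≡ ∑ (λ x → ∑ (λ y → h (f x y)) ys) xs
∑-cartesianProductWith h f []       ys = refl
∑-cartesianProductWith h f (x ∷ xs) ys = trans (∑-++ h (map (f x) ys) _)
  (cong₂ _+_ (∑-map h (f x) ys) (∑-cartesianProductWith h f xs ys))

≤∑ : ∀ (f : X → ℕ) {x xs} → x ∈ xs → f x ≤ ∑ f xs
≤∑ f (here refl) = m≤m+n _ _
≤∑ f (there x∈)  = ≤-trans (≤∑ f x∈) (m≤n+m _ _)

𝟙-yes : ∀ {P : Set} (P? : Dec P) → P → 1 ≤ 𝟙 P?
𝟙-yes (yes _) p = ≤-refl
𝟙-yes (no ¬p) p = contradiction p ¬p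

𝟙-split : ∀ {P : Set} (P? : Dec P) → 𝟙 P? + 𝟙 (¬? P?) ≡ 1
𝟙-split (yes _) = refl
𝟙-split (no _)  = refl

length-split : ∀ {P : X → Set} (P? : Decidable P) xs →
  length (filter P? xs) + length (filter (¬? ∘ P?) xs) ≡ length xs
length-split P? xs = begin
  length (filter P? xs) + length (filter (¬? ∘ P?) xs)
    ≡⟨ cong₂ _+_ (length-filter-𝟙 P? xs) (length-filter-𝟙 (¬? ∘ P?) xs) ⟩
  ∑ (𝟙 ∘ P?) xs + ∑ (𝟙 ∘ ¬? ∘ P?) xs     ≡⟨ ∑-+ (𝟙 ∘ P?) (𝟙 ∘ ¬? ∘ P?) xs ⟨
  ∑ (λ x → 𝟙 (P? x) + 𝟙 (¬? (P? x))) xs ≡⟨ ∑-cong xs (λ {x} _ → 𝟙-split (P? x)) ⟩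
  ∑ (λ _ → 1) xs                        ≡⟨ ∑-one xs ⟩
  length xs                             ∎
  where open ≡-Reasoning

𝟙-mono : ∀ {P Q : Set} (P? : Dec P) (Q? : Dec Q) → (P → Q) → 𝟙 P? ≤ 𝟙 Q?
𝟙-mono (no _)  _  _   = z≤n
𝟙-mono (yes p) Q? P⇒Q = 𝟙-yes Q? (P⇒Q p)

-- Arithmetic

^-distribʳ-* : ∀ n x y → (x * y) ^ n ≡ x ^ n * y ^ n
^-distribʳ-* zero    x y = refl
^-distribʳ-* (suc n) x y rewrite ^-distribʳ-* n x y = rearrange x y (x ^ n) (y ^ n)
  where
  rearrange : ∀ a b c d → a * b * (c * d) ≡ a * c * (b * d)
  rearrange = solve-∀

2xy≤x²+y² : ∀ x y → 2 * (x * y) ≤ x * x + y * y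
2xy≤x²+y² x y with ≤-total x y
... | inj₁ x≤y with k , refl ← m≤n⇒∃[o]m+o≡n x≤y =
  subst (2 * (x * (x + k)) ≤_) (expand x k) (m≤m+n _ (k * k))
  where
  expand : ∀ x k → 2 * (x * (x + k)) + k * k ≡ x * x + (x + k) * (x + k)
  expand = solve-∀
... | inj₂ y≤x with k , refl ← m≤n⇒∃[o]m+o≡n y≤x =
  subst (2 * ((y + k) * y) ≤_) (expand y k) (m≤m+n _ (k * k))
  where
  expand : ∀ y k → 2 * ((y + k) * y) + k * k ≡ (y + k) * (y + k) + y * y
  expand = solve-∀

-- Convexity of s^(n+1): the graph lies above its tangent at `p`, written without subtraction. The
-- induction multiplies by `s` and uses 2 s p ≤ s² + p², for which n s p^(n+1) is added to both
-- sides.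
power-above-tangent : ∀ n s p → suc n * (s * p ^ n) ≤ s ^ suc n + n * p ^ suc n
power-above-tangent zero    s p = ≤-reflexive (base s)
  where
  base : ∀ s → 1 * (s * 1) ≡ s * 1 + 0
  base = solve-∀
power-above-tangent (suc n) s p = +-cancelʳ-≤ (n * (s * (p * p ^ n))) _ _ (begin
  (2 + n) * (s * (p * p ^ n)) + n * (s * (p * p ^ n)) ≡⟨ eq₁ n s p (p ^ n) ⟩
  suc n * p ^ n * (2 * (s * p))                      ≤⟨ *-monoʳ-≤ (suc n * p ^ n) (2xy≤x²+y² s p) ⟩
  suc n * p ^ n * (s * s + p * p)                    ≡⟨ eq₂ n s p (p ^ n) ⟩
  s * (suc n * (s * p ^ n)) + suc n * (p * (p * p ^ n))
    ≤⟨ +-monoˡ-≤ _ (*-monoʳ-≤ s (power-above-tangent n s p)) ⟩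
  s * (s ^ suc n + n * p ^ suc n) + suc n * (p * (p * p ^ n)) ≡⟨ eq₃ n s p (p ^ n) (s ^ n) ⟩
  s ^ (2 + n) + suc n * p ^ (2 + n) + n * (s * (p * p ^ n)) ∎)
  where
  open ≤-Reasoning
  eq₁ : ∀ n s p q → (2 + n) * (s * (p * q)) + n * (s * (p * q)) ≡ suc n * q * (2 * (s * p))
  eq₁ = solve-∀
  eq₂ : ∀ n s p q → suc n * q * (s * s + p * p) ≡ s * (suc n * (s * q)) + suc n * (p * (p * q))
  eq₂ = solve-∀
  eq₃ : ∀ n s p q r → s * (s * r + n * (p * q)) + suc n * (p * (p * q))
                    ≡ s * (s * r) + suc n * (p * (p * q)) + n * (s * (p * q))
  eq₃ = solve-∀

-- The tangent to the power at p = (n + 1) x, evaluated at s = n (x + y); a common factor n then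
-- cancels.
weighted-AM-GM : ∀ n .{{_ : NonZero n}} x y →
  suc n ^ suc n * (x ^ n * y) ≤ n ^ n * (x + y) ^ suc n
weighted-AM-GM n x y = *-cancelˡ-≤ n (+-cancelʳ-≤ (n * p ^ suc n) _ _ (begin
  n * (suc n ^ suc n * (x ^ n * y)) + n * (p * p ^ n)
    ≡⟨ cong (λ z → n * (suc n ^ suc n * (x ^ n * y)) + n * (p * z)) (^-distribʳ-* n (suc n) x) ⟩
  n * (suc n ^ suc n * (x ^ n * y)) + n * (p * (suc n ^ n * x ^ n))
    ≡⟨ eq₁ n x y (suc n ^ n) (x ^ n) ⟩
  suc n * (s * (suc n ^ n * x ^ n))   ≡⟨ cong (λ z → suc n * (s * z)) (^-distribʳ-* n (suc n) x) ⟨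
  suc n * (s * p ^ n)                 ≤⟨ power-above-tangent n s p ⟩
  s ^ suc n + n * p ^ suc n           ≡⟨ cong (_+ n * p ^ suc n) (^-distribʳ-* (suc n) n (x + y)) ⟩
  n * n ^ n * (x + y) ^ suc n + n * p ^ suc n ≡⟨ cong (_+ n * p ^ suc n) (*-assoc n (n ^ n) _) ⟩
  n * (n ^ n * (x + y) ^ suc n) + n * p ^ suc n ∎))
  where
  open ≤-Reasoning
  s = n * (x + y)
  p = suc n * x
  eq₁ : ∀ n x y c z → n * (suc n * c * (z * y)) + n * (suc n * x * (c * z))
                    ≡ suc n * (n * (x + y) * (c * z))
  eq₁ = solve-∀

-- The hypotheses bound the slopes u / v by the (n + 1)-th root of `K`, and the slope of the sum is
-- at most the larger one. Slopes are compared by cross-multiplication because `v₁` and `v₂` may be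
-- 0.
power-cone-+ : ∀ n K {u₁ u₂ v₁ v₂} → u₁ ^ suc n ≤ v₁ ^ suc n * K → u₂ ^ suc n ≤ v₂ ^ suc n * K →
  (u₁ + u₂) ^ suc n ≤ (v₁ + v₂) ^ suc n * K
power-cone-+ n K {u₁} {u₂} {v₁} {v₂} p₁ p₂ = Sum.[ steeper u₁ v₁ p₁ p₂ , swapped ]′ (≤-total (u₁ * v₂) (u₂ * v₁))
  where
  open ≤-Reasoning

  swap : ∀ x y z → x * y * z ≡ z * y * x
  swap = solve-∀

  steeper : ∀ u₁ v₁ {u₂ v₂} → u₁ ^ suc n ≤ v₁ ^ suc n * K → u₂ ^ suc n ≤ v₂ ^ suc n * K →
    u₁ * v₂ ≤ u₂ * v₁ → (u₁ + u₂) ^ suc n ≤ (v₁ + v₂) ^ suc n * K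
  steeper u₁ v₁ {zero}   {zero} p₁ p₂ le rewrite +-identityʳ u₁ | +-identityʳ v₁ = p₁
  steeper u₁ v₁ {suc u₂} {zero} p₁ p₂ le = contradiction p₂ (<⇒≱ (m^n>0 (suc u₂) (suc n)))
  steeper u₁ v₁ {u₂} {v₂@(suc _)} p₁ p₂ le = *-cancelʳ-≤ _ _ (v₂ ^ suc n) {{m^n≢0 v₂ (suc n)}} (begin
    (u₁ + u₂) ^ suc n * v₂ ^ suc n     ≡⟨ ^-distribʳ-* (suc n) (u₁ + u₂) v₂ ⟨
    ((u₁ + u₂) * v₂) ^ suc n           ≤⟨ ^-monoˡ-≤ (suc n) slope ⟩
    (u₂ * (v₁ + v₂)) ^ suc n           ≡⟨ ^-distribʳ-* (suc n) u₂ (v₁ + v₂) ⟩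
    u₂ ^ suc n * (v₁ + v₂) ^ suc n     ≤⟨ *-monoˡ-≤ _ p₂ ⟩
    v₂ ^ suc n * K * (v₁ + v₂) ^ suc n ≡⟨ swap (v₂ ^ suc n) K ((v₁ + v₂) ^ suc n) ⟩
    (v₁ + v₂) ^ suc n * K * v₂ ^ suc n ∎)
    where
    slope : (u₁ + u₂) * v₂ ≤ u₂ * (v₁ + v₂)
    slope = begin
      (u₁ + u₂) * v₂    ≡⟨ *-distribʳ-+ v₂ u₁ u₂ ⟩
      u₁ * v₂ + u₂ * v₂ ≤⟨ +-monoˡ-≤ _ le ⟩
      u₂ * v₁ + u₂ * v₂ ≡⟨ *-distribˡ-+ u₂ v₁ v₂ ⟨
      u₂ * (v₁ + v₂)    ∎

  swapped : u₂ * v₁ ≤ u₁ * v₂ → (u₁ + u₂) ^ suc n ≤ (v₁ + v₂) ^ suc n * K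
  swapped ge rewrite +-comm u₁ u₂ | +-comm v₁ v₂ = steeper u₂ v₂ p₂ p₁ ge

rearrangement : ∀ {a b c d} → a ≤ b → c ≤ d → a * d + b * c ≤ a * c + b * d
rearrangement {a} {b} {c} {d} a≤b c≤d
  with x , refl ← m≤n⇒∃[o]m+o≡n a≤b | y , refl ← m≤n⇒∃[o]m+o≡n c≤d =
  subst (a * (c + y) + (a + x) * c ≤_) (expand a c x y) (m≤m+n _ (x * y))
  where
  expand : ∀ a c x y → a * (c + y) + (a + x) * c + x * y ≡ a * c + (a + x) * (c + y)
  expand = solve-∀

-- Slicings and the Loomis–Whitney inequality

-- Profile D m b says that a set of m points in dimension D, whose projections
-- have total size b, can be sliced along each of its D directions into sets of
-- the same kind in dimension D − 1, the slices being no larger than the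
-- projection (of size M) in that direction.
Slicing : (ℕ → ℕ → Set) → (M m b : ℕ) → Set
Slicing P M m b = Σ[ ps ∈ List (ℕ × ℕ) ]
  All (λ (m′ , b′) → m′ ≤ M × P m′ b′) ps × ∑ proj₁ ps ≡ m × M + ∑ proj₂ ps ≤ b

Profile : (D m b : ℕ) → Set
Profile zero    m b = ⊤
Profile (suc D) m b = Σ[ Ms ∈ List ℕ ]
  length Ms ≡ suc D × sum Ms ≡ b × All (λ M → Slicing (Profile D) M m b) Ms

-- Loomis-Whitney, m^(d-1) ≤ ∏ Mᵢ with d = D + 1, where the product is replaced by the d-th power of
-- the mean projection b / d. The induction slices along the first direction: each slice satisfies
-- the inequality with its size on the right raised to `M`, the cone property adds up the slices,
-- and AM-GM turns β^(d-1) M into a power of β + M ≤ b.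
loomis-whitney : ∀ D {m b} → Profile (suc D) m b → 1 ≤ m → (suc D * m) ^ suc D ≤ b ^ suc D * m
loomis-whitney zero {m} {b} (M ∷ [] , refl , refl , (ps , slices , refl , _) ∷ []) 1≤m = begin
  (1 * m) ^ 1       ≡⟨ eq m ⟩
  1 * m             ≤⟨ *-monoˡ-≤ m 1≤b ⟩
  b * m             ≡⟨ cong (_* m) (*-identityʳ b) ⟨
  b ^ 1 * m         ∎
  where
  open ≤-Reasoning
  eq : ∀ m → (1 * m) * 1 ≡ 1 * m
  eq = solve-∀
  nonempty : ∀ {ps : List (ℕ × ℕ)} → All (λ (m′ , b′) → m′ ≤ M × ⊤) ps → 1 ≤ ∑ proj₁ ps → 1 ≤ M
  nonempty {(zero  , _) ∷ _} (_         ∷ ss) 1≤ = nonempty ss 1≤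
  nonempty {(suc _ , _) ∷ _} ((m′≤M , _) ∷ ss) 1≤ = ≤-trans (s≤s z≤n) m′≤M
  1≤b : 1 ≤ b
  1≤b = ≤-trans (nonempty slices 1≤m) (m≤m+n M 0)
loomis-whitney (suc D) {m} {b} (M ∷ Ms , _ , refl , (ps , slices , refl , M+β≤b) ∷ _) 1≤m =
  *-cancelˡ-≤ (n ^ n) {{m^n≢0 n n}} (begin
    n ^ n * (suc n * m) ^ suc n           ≡⟨ cong (n ^ n *_) (^-distribʳ-* (suc n) (suc n) m) ⟩
    n ^ n * (suc n ^ suc n * m ^ suc n)   ≡⟨ eq₁ (n ^ n) (suc n ^ suc n) m (m ^ n) ⟩
    suc n ^ suc n * (n ^ n * m ^ n) * m   ≡⟨ cong (λ z → suc n ^ suc n * z * m) (^-distribʳ-* n n m) ⟨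
    suc n ^ suc n * (n * m) ^ n * m       ≤⟨ *-monoˡ-≤ m (*-monoʳ-≤ (suc n ^ suc n) (sliced slices)) ⟩
    suc n ^ suc n * (β ^ n * M) * m       ≤⟨ *-monoˡ-≤ m (weighted-AM-GM n β M) ⟩
    n ^ n * (β + M) ^ suc n * m           ≤⟨ *-monoˡ-≤ m (*-monoʳ-≤ (n ^ n) (^-monoˡ-≤ (suc n) β+M≤b)) ⟩
    n ^ n * b ^ suc n * m                 ≡⟨ *-assoc (n ^ n) _ m ⟩
    n ^ n * (b ^ suc n * m)               ∎)
  where
  open ≤-Reasoning
  n = suc D
  β = ∑ proj₂ ps
  β+M≤b : β + M ≤ b
  β+M≤b = subst (_≤ b) (+-comm M β) M+β≤b
  eq₁ : ∀ c d m p → c * (d * (m * p)) ≡ d * (c * p) * m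
  eq₁ = solve-∀
  zero-power : (n * 0) ^ n ≡ 0
  zero-power rewrite *-zeroʳ n = refl
  one : ∀ m′ b′ → m′ ≤ M → Profile n m′ b′ → (n * m′) ^ n ≤ b′ ^ n * M
  one zero    b′ _    _ = ≤-trans (≤-reflexive zero-power) z≤n
  one (suc m′) b′ m′≤M p =
    ≤-trans (loomis-whitney D p (s≤s z≤n)) (*-monoʳ-≤ (b′ ^ n) m′≤M)
  sliced : ∀ {ps} → All (λ (m′ , b′) → m′ ≤ M × Profile n m′ b′) ps →
    (n * ∑ proj₁ ps) ^ n ≤ ∑ proj₂ ps ^ n * M
  sliced []                                     = ≤-trans (≤-reflexive zero-power) z≤n
  sliced {(m′ , b′) ∷ ps} ((m′≤M , p) ∷ ss)
    rewrite *-distribˡ-+ n m′ (∑ proj₁ ps) =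
    power-cone-+ D M {n * m′} {n * ∑ proj₁ ps} {b′} (one m′ b′ m′≤M p) (sliced ss)

-- The hypothesis puts the mean projection below m / C, and Loomis-Whitney then gives the size.
-- Contrapositively, a set of at most C^(D+1) points has a direction with m ≤ C M.
thick-in-every-direction : ∀ D {m b} C → Profile (suc D) m b → C * b < suc D * m → C ^ suc D < m
thick-in-every-direction D {zero} C p Cb< rewrite *-zeroʳ D = contradiction Cb< λ ()
thick-in-every-direction D {m@(suc _)} {b} C p Cb< = *-cancelˡ-< (b ^ n) _ _ (begin-strict
  b ^ n * C ^ n  ≡⟨ *-comm (b ^ n) (C ^ n) ⟩
  C ^ n * b ^ n  ≡⟨ ^-distribʳ-* n C b ⟨
  (C * b) ^ n    <⟨ ^-monoˡ-< n Cb< ⟩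
  (n * m) ^ n    ≤⟨ loomis-whitney D p (s≤s z≤n) ⟩
  b ^ n * m      ∎)
  where
  open ≤-Reasoning
  n = suc D

-- The tangent inequality

sq : ℕ → ℕ
sq x = x * x

∑sq≤∑*M : ∀ {M} {ps : List (ℕ × ℕ)} → All (λ p → proj₁ p ≤ M) ps → ∑ (sq ∘ proj₁) ps ≤ ∑ proj₁ ps * M
∑sq≤∑*M []                       = z≤n
∑sq≤∑*M {M} {(x , _) ∷ ps} (x≤M ∷ ≤Ms)
  rewrite *-distribʳ-+ M x (∑ proj₁ ps) = +-mono-≤ (*-monoʳ-≤ x x≤M) (∑sq≤∑*M ≤Ms)

-- Among numbers in [0 , M] with sum s, the sum of squares is largest when all
-- but one of them are 0 or M; this is its bound A M² + (s − A M)², which holds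
-- for every A but is sharp for A = ⌊s / M⌋.
∑sq-concentrated : ∀ {M} A {ps : List (ℕ × ℕ)} → All (λ p → proj₁ p ≤ M) ps → let s = ∑ proj₁ ps in
  ∑ (sq ∘ proj₁) ps + 2 * (A * M * s) ≤ A * (M * M) + s * s + A * M * (A * M)
∑sq-concentrated {M} A [] = ≤-trans (≤-reflexive (cong (2 *_) (*-zeroʳ (A * M)))) z≤n
-- If the tail has sum at least A M, the same `A` serves for it; otherwise one of the A full entries
-- is charged to `x`, and the tail is bounded with A - 1.
∑sq-concentrated {M} A {(x , _) ∷ ps} (x≤M ∷ ≤Ms) = Sum.[ below A , above A ]′ (≤-total (A * M) s)
  where
  open ≤-Reasoning
  s = ∑ proj₁ ps
  σ = ∑ (sq ∘ proj₁) ps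

  eq₁ : ∀ σ x y s → x * x + σ + 2 * (y * (x + s)) ≡ (σ + 2 * (y * s)) + (x * x + 2 * (x * y))
  eq₁ = solve-∀
  eq₂ : ∀ A M x s y → A * (M * M) + s * s + y * y + (x * x + 2 * (x * s))
                    ≡ A * (M * M) + (x + s) * (x + s) + y * y
  eq₂ = solve-∀
  eq₃ : ∀ σ x M N s → x * x + σ + 2 * ((M + N) * (x + s))
                    ≡ (σ + 2 * (N * s)) + (x * x + 2 * (x * (M + N) + M * s))
  eq₃ = solve-∀
  eq₄ : ∀ A x M N s → A * (M * M) + s * s + N * N + (x * x + 2 * (x * s + M * (M + N)))
                    ≡ suc A * (M * M) + (x + s) * (x + s) + (M + N) * (M + N)
  eq₄ = solve-∀

  below : ∀ A → A * M ≤ s →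
    x * x + σ + 2 * (A * M * (x + s)) ≤ A * (M * M) + (x + s) * (x + s) + A * M * (A * M)
  below A AM≤s = begin
    x * x + σ + 2 * (A * M * (x + s))                ≡⟨ eq₁ σ x (A * M) s ⟩
    (σ + 2 * (A * M * s)) + (x * x + 2 * (x * (A * M)))
      ≤⟨ +-mono-≤ (∑sq-concentrated A ≤Ms) (+-monoʳ-≤ (x * x) (*-monoʳ-≤ 2 (*-monoʳ-≤ x AM≤s))) ⟩
    A * (M * M) + s * s + A * M * (A * M) + (x * x + 2 * (x * s)) ≡⟨ eq₂ A M x s (A * M) ⟩
    A * (M * M) + (x + s) * (x + s) + A * M * (A * M) ∎

  above : ∀ A → s ≤ A * M →
    x * x + σ + 2 * (A * M * (x + s)) ≤ A * (M * M) + (x + s) * (x + s) + A * M * (A * M)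
  above zero    _    = below zero z≤n
  above (suc A) s≤AM = begin
    x * x + σ + 2 * ((M + N) * (x + s))                            ≡⟨ eq₃ σ x M N s ⟩
    (σ + 2 * (N * s)) + (x * x + 2 * (x * (M + N) + M * s))
      ≤⟨ +-mono-≤ (∑sq-concentrated A ≤Ms) (+-monoʳ-≤ (x * x) (*-monoʳ-≤ 2 (rearrangement x≤M s≤AM))) ⟩
    A * (M * M) + s * s + N * N + (x * x + 2 * (x * s + M * (M + N))) ≡⟨ eq₄ A x M N s ⟩
    suc A * (M * M) + (x + s) * (x + s) + (M + N) * (M + N)        ∎
    where N = A * M

-- n c^(n−1)
dpow : ℕ → ℕ → ℕ
dpow c zero    = 0
dpow c (suc n) = c ^ n + c * dpow c n

dpow-value : ∀ c n → dpow c (suc n) ≡ suc n * c ^ n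
dpow-value c zero    rewrite *-zeroʳ c = refl
dpow-value c (suc n) rewrite dpow-value c n = eq c n (c ^ n)
  where
  eq : ∀ c n x → c * x + c * (suc n * x) ≡ (2 + n) * (c * x)
  eq = solve-∀

≤-splits : ∀ {P Q : ℕ → Set} {Ms} → (∀ x → P x ⊎ Q x) → All Q Ms ⊎ Any P Ms
≤-splits dec = All.decide (Sum.swap ∘ dec) _

-- The induction step of the tangent inequality: s stands for the sum of the
-- squared slice sizes, and C is the side that the slices do without.
add-side : ∀ {m b M β s Π E} C → m * E ≤ β * Π + s → M + β ≤ b →
  C * s + m * Π ≤ C * M * Π + m * m → m * (Π + C * E) ≤ b * (C * Π) + m * m
add-side {m} {b} {M} {β} {s} {Π} {E} C slices M+β≤b gain = begin
  m * (Π + C * E)                   ≡⟨ eq₁ m Π C E ⟩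
  m * Π + C * (m * E)               ≤⟨ +-monoʳ-≤ (m * Π) (*-monoʳ-≤ C slices) ⟩
  m * Π + C * (β * Π + s)           ≡⟨ eq₂ m Π C β s ⟩
  C * β * Π + (C * s + m * Π)       ≤⟨ +-monoʳ-≤ (C * β * Π) gain ⟩
  C * β * Π + (C * M * Π + m * m)   ≡⟨ eq₃ C β Π M m ⟩
  (M + β) * (C * Π) + m * m         ≤⟨ +-monoˡ-≤ (m * m) (*-monoˡ-≤ (C * Π) M+β≤b) ⟩
  b * (C * Π) + m * m               ∎
  where
  open ≤-Reasoning
  eq₁ : ∀ m Π C E → m * (Π + C * E) ≡ m * Π + C * (m * E)
  eq₁ = solve-∀
  eq₂ : ∀ m Π C β s → m * Π + C * (β * Π + s) ≡ C * β * Π + (C * s + m * Π)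
  eq₂ = solve-∀
  eq₃ : ∀ C β Π M m → C * β * Π + (C * M * Π + m * m) ≡ (M + β) * (C * Π) + m * m
  eq₃ = solve-∀

-- Once `s` is replaced by m M, what remains is (C M - m)(Π - m) ≥ 0.
same-side : ∀ {m M s Π} C → s ≤ m * M → (m ≤ C * M × m ≤ Π) ⊎ (C * M ≤ m × Π ≤ m) →
  C * s + m * Π ≤ C * M * Π + m * m
same-side {m} {M} {s} {Π} C s≤mM side = begin
  C * s + m * Π            ≤⟨ +-monoˡ-≤ (m * Π) (*-monoʳ-≤ C s≤mM) ⟩
  C * (m * M) + m * Π      ≡⟨ eq C m M Π ⟩
  m * Π + C * M * m        ≤⟨ Sum.[ lower , upper ]′ side ⟩
  C * M * Π + m * m        ∎
  where
  open ≤-Reasoning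
  eq : ∀ C m M Π → C * (m * M) + m * Π ≡ m * Π + C * M * m
  eq = solve-∀
  lower : m ≤ C * M × m ≤ Π → m * Π + C * M * m ≤ C * M * Π + m * m
  lower (p , q) = subst (m * Π + C * M * m ≤_) (+-comm (m * m) _) (rearrangement p q)
  upper : C * M ≤ m × Π ≤ m → m * Π + C * M * m ≤ C * M * Π + m * m
  upper (p , q) = subst (_≤ C * M * Π + m * m) (+-comm (C * M * m) _) (rearrangement p q)

-- For A M ≤ m ≤ B M, slices of average thickness between A and B, the slices do
-- without A or without B according as Q ≤ M or M ≤ Q, where Q is the product of
-- the sides other than one A and one B.
between-large : ∀ u v {Q s Π} A₀ → let A = suc A₀; B = suc A; M = u + v; m = A * M + u in
  s ≤ A * (M * M) + u * u → Π ≡ B * Q → Q ≤ M → A * s + m * Π ≤ A * M * Π + m * m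
between-large u v {Q} {s} A₀ s≤ refl Q≤M = begin
  A * s + m * (B * Q)                              ≤⟨ +-monoˡ-≤ (m * (B * Q)) (*-monoʳ-≤ A s≤) ⟩
  A * (A * (M * M) + u * u) + m * (B * Q)          ≡⟨ eq₁ A₀ u v Q ⟩
  A * M * (B * Q) + A * M * (A * M) + A * (u * u) + u * B * Q
    ≤⟨ +-monoʳ-≤ (A * M * (B * Q) + A * M * (A * M) + A * (u * u)) (*-monoʳ-≤ (u * B) Q≤M) ⟩
  A * M * (B * Q) + A * M * (A * M) + A * (u * u) + u * B * M
    ≤⟨ m≤m+n _ (A₀ * (u * v)) ⟩
  A * M * (B * Q) + A * M * (A * M) + A * (u * u) + u * B * M + A₀ * (u * v) ≡⟨ eq₂ A₀ u v Q ⟩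
  A * M * (B * Q) + m * m                          ∎
  where
  open ≤-Reasoning
  A = suc A₀
  B = suc A
  M = u + v
  m = A * M + u
  eq₁ : ∀ a u v Q → suc a * (suc a * ((u + v) * (u + v)) + u * u) + (suc a * (u + v) + u) * ((2 + a) * Q)
    ≡ suc a * (u + v) * ((2 + a) * Q) + suc a * (u + v) * (suc a * (u + v)) + suc a * (u * u) + u * (2 + a) * Q
  eq₁ = solve-∀
  eq₂ : ∀ a u v Q → suc a * (u + v) * ((2 + a) * Q) + suc a * (u + v) * (suc a * (u + v)) + suc a * (u * u)
      + u * (2 + a) * (u + v) + a * (u * v)
    ≡ suc a * (u + v) * ((2 + a) * Q) + (suc a * (u + v) + u) * (suc a * (u + v) + u)
  eq₂ = solve-∀

between-small : ∀ u v {Q s Π} A → let B = suc A; M = u + v; m = A * M + u in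
  s ≤ A * (M * M) + u * u → Π ≡ A * Q → M ≤ Q → B * s + m * Π ≤ B * M * Π + m * m
between-small u v {_} {s} A s≤ refl M≤Q with r , refl ← m≤n⇒∃[o]m+o≡n M≤Q = begin
  B * s + m * (A * Q)                              ≤⟨ +-monoˡ-≤ (m * (A * Q)) (*-monoʳ-≤ B s≤) ⟩
  B * (A * (M * M) + u * u) + m * (A * Q)          ≤⟨ m≤m+n _ (A * v * (u + r)) ⟩
  B * (A * (M * M) + u * u) + m * (A * Q) + A * v * (u + r) ≡⟨ eq A u v r ⟩
  B * M * (A * Q) + m * m                          ∎
  where
  open ≤-Reasoning
  B = suc A
  M = u + v
  m = A * M + u
  Q = u + v + r
  eq : ∀ A u v r → suc A * (A * ((u + v) * (u + v)) + u * u) + (A * (u + v) + u) * (A * (u + v + r))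
      + A * v * (u + r)
    ≡ suc A * (u + v) * (A * (u + v + r)) + (A * (u + v) + u) * (A * (u + v) + u)
  eq = solve-∀

*sum≤ : ∀ {m} C {Ms} → All (λ M → C * M ≤ m) Ms → C * sum Ms ≤ length Ms * m
*sum≤ C []                          = ≤-reflexive (*-zeroʳ C)
*sum≤ C {M ∷ Ms} (p ∷ ps) rewrite *-distribˡ-+ C M (sum Ms) = +-mono-≤ p (*sum≤ C ps)

≤*sum : ∀ {m} C {Ms} → All (λ M → m ≤ C * M) Ms → length Ms * m ≤ C * sum Ms
≤*sum C []                          = z≤n
≤*sum C {M ∷ Ms} (p ∷ ps) rewrite *-distribˡ-+ C M (sum Ms) = +-mono-≤ p (≤*sum C ps)

*sum< : ∀ {m n} C {Ms} → length Ms ≡ suc n → All (λ M → C * M < m) Ms → C * sum Ms < suc n * m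
*sum< C {M ∷ Ms} refl (p ∷ ps) rewrite *-distribˡ-+ C M (sum Ms) =
  +-mono-<-≤ p (*sum≤ C (All.map <⇒≤ ps))

module _ (D Π E : ℕ)
         (slice-bound : ∀ {m b} → Profile D m b → m * E ≤ b * Π + m * m) where

  slices-bound : ∀ {M ps} → All (λ (m′ , b′) → m′ ≤ M × Profile D m′ b′) ps →
    ∑ proj₁ ps * E ≤ ∑ proj₂ ps * Π + ∑ (sq ∘ proj₁) ps
  slices-bound [] = z≤n
  slices-bound {ps = (x , y) ∷ ps} ((_ , p) ∷ ss)
    rewrite *-distribʳ-+ E x (∑ proj₁ ps) | *-distribʳ-+ Π y (∑ proj₂ ps) =
    ≤-trans (+-mono-≤ (slice-bound p) (slices-bound ss)) (≤-reflexive (eq (y * Π) (x * x) _ _))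
    where
    eq : ∀ a b c d → a + b + (c + d) ≡ a + c + (b + d)
    eq = solve-∀

  by-slicing : ∀ {M m b} C → Slicing (Profile D) M m b →
    (∀ {s} → s ≤ m * M → (∀ A → s + 2 * (A * M * m) ≤ A * (M * M) + m * m + A * M * (A * M)) →
      C * s + m * Π ≤ C * M * Π + m * m) →
    m * (Π + C * E) ≤ b * (C * Π) + m * m
  by-slicing {b = b} C (ps , ss , refl , M+β≤b) gain =
    add-side {∑ proj₁ ps} {b} {β = ∑ proj₂ ps} {E = E} C (slices-bound ss) M+β≤b
      (gain (∑sq≤∑*M sizes) (λ A → ∑sq-concentrated A sizes))
    where sizes = All.map proj₁ ss

  same-side-slicing : ∀ {M m b} C → Slicing (Profile D) M m b →
    (m ≤ C * M × m ≤ Π) ⊎ (C * M ≤ m × Π ≤ m) → m * (Π + C * E) ≤ b * (C * Π) + m * m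
  same-side-slicing C sl side = by-slicing C sl (λ s≤ _ → same-side C s≤ side)

  -- A direction with m ≤ C M suffices, by `same-side`. If there were none, the set would have more
  -- than C^(D+1) ≥ Π points.
  small-set : ∀ {m b} C → Profile (suc D) m b → m ≤ Π → Π ≤ C ^ suc D →
    m * (Π + C * E) ≤ b * (C * Π) + m * m
  small-set {m} C P@(Ms , len , refl , slicings) m≤Π Π≤Cᴰ
    with ≤-splits {P = λ M → m ≤ C * M} {Q = λ M → C * M < m} {Ms} (λ M → ≤-<-connex m (C * M))
  ... | inj₁ all = contradiction (≤-trans m≤Π Π≤Cᴰ) (<⇒≱ (thick-in-every-direction D C P (*sum< C len all)))
  ... | inj₂ any with sl , m≤CM ← All.lookupAny slicings any = same-side-slicing C sl (inj₁ (m≤CM , m≤Π))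

  -- Here no slicing is used: the projections alone give (D + 1) m ≤ C b. The number `Π + C * E` is
  -- the sum of the D + 2 products of all sides but one, so the last hypothesis holds when `C` is
  -- the smallest side.
  large-thin-set : ∀ {m Ms b} C → length Ms ≡ suc D → sum Ms ≡ b → All (λ M → m ≤ C * M) Ms →
    Π ≤ m → Π + C * E ≤ (2 + D) * Π → m * (Π + C * E) ≤ b * (C * Π) + m * m
  large-thin-set {m} {Ms} C len refl all Π≤m E≤ = begin
    m * (Π + C * E)                    ≤⟨ *-monoʳ-≤ m E≤ ⟩
    m * ((2 + D) * Π)                  ≡⟨ eq₁ m D Π ⟩
    suc D * m * Π + m * Π              ≤⟨ +-mono-≤ (*-monoˡ-≤ Π (subst (λ n → n * m ≤ C * sum Ms) len (≤*sum C all)))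
                                                   (*-monoʳ-≤ m Π≤m) ⟩
    C * sum Ms * Π + m * m             ≡⟨ eq₂ C (sum Ms) Π m ⟩
    sum Ms * (C * Π) + m * m           ∎
    where
    open ≤-Reasoning
    eq₁ : ∀ m D Π → m * ((2 + D) * Π) ≡ suc D * m * Π + m * Π
    eq₁ = solve-∀
    eq₂ : ∀ C b Π m → C * b * Π + m * m ≡ b * (C * Π) + m * m
    eq₂ = solve-∀

  large-set : ∀ {m b} C → Profile (suc D) m b → Π ≤ m → Π + C * E ≤ (2 + D) * Π →
    m * (Π + C * E) ≤ b * (C * Π) + m * m
  large-set {m} C (Ms , len , refl , slicings) Π≤m E≤
    with ≤-splits {P = λ M → C * M ≤ m} {Q = λ M → m < C * M} {Ms} (λ M → ≤-<-connex (C * M) m)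
  ... | inj₁ all = large-thin-set C len refl (All.map <⇒≤ all) Π≤m E≤
  ... | inj₂ any with sl , CM≤m ← All.lookupAny slicings any = same-side-slicing C sl (inj₂ (CM≤m , Π≤m))

module Tangent (A₀ : ℕ) where

  A B : ℕ
  A = suc A₀
  B = suc A

  -- For a (D+1)-dimensional box with i sides A and j sides B these are the
  -- volume and its derivative e_D(sides); then b Π + m² ≥ m E is equality for
  -- the D-dimensional boxes obtained by dropping any one of the sides.
  Π E : ℕ → ℕ → ℕ
  Π i j = A ^ i * B ^ j
  E i j = dpow A i * B ^ j + A ^ i * dpow B j

  E-add-A : ∀ i j → E (suc i) j ≡ Π i j + A * E i j
  E-add-A i j = eq A (A ^ i) (dpow A i) (B ^ j) (dpow B j)
    where
    eq : ∀ A p dp q dq → (p + A * dp) * q + A * p * dq ≡ p * q + A * (dp * q + p * dq)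
    eq = solve-∀

  E-add-B : ∀ i j → E i (suc j) ≡ Π i j + B * E i j
  E-add-B i j = eq B (A ^ i) (dpow A i) (B ^ j) (dpow B j)
    where
    eq : ∀ B p dp q dq → dp * (B * q) + p * (q + B * dq) ≡ p * q + B * (dp * q + p * dq)
    eq = solve-∀

  Π-add-A : ∀ i j → Π (suc i) j ≡ A * Π i j
  Π-add-A i j = *-assoc A (A ^ i) (B ^ j)

  Π-add-B : ∀ i j → Π i (suc j) ≡ B * Π i j
  Π-add-B i j = eq (A ^ i) B (B ^ j)
    where
    eq : ∀ p B q → p * (B * q) ≡ B * (p * q)
    eq = solve-∀

  Π≤B^ : ∀ i j → Π i j ≤ B ^ (i + j)
  Π≤B^ i j = ≤-trans (*-monoˡ-≤ (B ^ j) (^-monoˡ-≤ i (n≤1+n A))) (≤-reflexive (sym (^-distribˡ-+-* B i j)))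

  A*dpowB≤ : ∀ j → A * dpow B j ≤ j * B ^ j
  A*dpowB≤ zero    = ≤-reflexive (*-zeroʳ A)
  A*dpowB≤ (suc j) rewrite dpow-value B j = begin
    A * (suc j * B ^ j)   ≤⟨ *-monoˡ-≤ (suc j * B ^ j) (n≤1+n A) ⟩
    B * (suc j * B ^ j)   ≡⟨ eq B (suc j) (B ^ j) ⟩
    suc j * B ^ suc j     ∎
    where
    open ≤-Reasoning
    eq : ∀ b c d → b * (c * d) ≡ c * (b * d)
    eq = solve-∀

  E≤-A : ∀ i j → Π i j + A * E i j ≤ (suc i + j) * Π i j
  E≤-A i j rewrite sym (E-add-A i j) | dpow-value A i = begin
    suc i * A ^ i * B ^ j + A * A ^ i * dpow B j   ≡⟨ eq₁ i (A ^ i) (B ^ j) A (dpow B j) ⟩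
    suc i * Π i j + A ^ i * (A * dpow B j)         ≤⟨ +-monoʳ-≤ (suc i * Π i j) (*-monoʳ-≤ (A ^ i) (A*dpowB≤ j)) ⟩
    suc i * Π i j + A ^ i * (j * B ^ j)            ≡⟨ eq₂ i j (A ^ i) (B ^ j) ⟩
    (suc i + j) * Π i j                            ∎
    where
    open ≤-Reasoning
    eq₁ : ∀ i p q A d → suc i * p * q + A * p * d ≡ suc i * (p * q) + p * (A * d)
    eq₁ = solve-∀
    eq₂ : ∀ i j p q → suc i * (p * q) + p * (j * q) ≡ (suc i + j) * (p * q)
    eq₂ = solve-∀

  E≤-B : ∀ j → Π 0 j + B * E 0 j ≤ suc j * Π 0 j
  E≤-B j rewrite sym (E-add-B 0 j) | dpow-value B j = ≤-reflexive (eq (suc j) (B ^ j))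
    where
    eq : ∀ a b → 1 * (a * b) ≡ a * (1 * b)
    eq = solve-∀

  -- For u ≤ M this is the sum of squares of A slices of size `M` and one of size `u`.
  sq-between : ∀ {s} M u → let m = A * M + u in
    s + 2 * (A * M * m) ≤ A * (M * M) + m * m + A * M * (A * M) → s ≤ A * (M * M) + u * u
  sq-between M u le =
    +-cancelʳ-≤ (2 * (A * M * (A * M + u))) _ _ (≤-trans le (≤-reflexive (eq (A * (M * M)) (A * M) u)))
    where
    eq : ∀ c y u → c + (y + u) * (y + u) + y * y ≡ c + u * u + 2 * (y * (y + u))
    eq = solve-∀

  Bound : (m b i j : ℕ) → Set
  Bound m b i j = m * E i j ≤ b * Π i j + m * m

  from-A : ∀ m b i j → m * (Π i j + A * E i j) ≤ b * (A * Π i j) + m * m → Bound m b (suc i) j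
  from-A m b i j = subst₂ (λ x y → m * x ≤ b * y + m * m) (sym (E-add-A i j)) (sym (Π-add-A i j))

  from-B : ∀ m b i j → m * (Π i j + B * E i j) ≤ b * (B * Π i j) + m * m → Bound m b i (suc j)
  from-B m b i j = subst₂ (λ x y → m * x ≤ b * y + m * m) (sym (E-add-B i j)) (sym (Π-add-B i j))

  module Step (D : ℕ) (ih : ∀ i j → i + j ≡ suc D → ∀ {m b} → Profile D m b → Bound m b i j) where

    between : ∀ i j u v {b} → let M = u + v in suc i + j ≡ suc D →
      Slicing (Profile D) M (A * M + u) b → Bound (A * M + u) b (suc i) (suc j)
    between i j u v {b} eq sl with ≤-total (Π i j) (u + v)
    ... | inj₁ Q≤M = from-A (A * (u + v) + u) b i (suc j) (by-slicing D (Π i (suc j)) (E i (suc j))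
      (ih i (suc j) (trans (+-suc i j) eq)) A sl
      (λ {s} _ conc → between-large u v A₀ (sq-between {s} (u + v) u (conc A)) (Π-add-B i j) Q≤M))
    ... | inj₂ M≤Q = from-B (A * (u + v) + u) b (suc i) j (by-slicing D (Π (suc i) j) (E (suc i) j) (ih (suc i) j eq) B sl
      (λ {s} _ conc → between-small u v A (sq-between {s} (u + v) u (conc A)) (Π-add-A i j) M≤Q))

    between′ : ∀ i j {M m b} → suc i + j ≡ suc D → A * M ≤ m → m ≤ B * M →
      Slicing (Profile D) M m b → Bound m b (suc i) (suc j)
    between′ i j {M} eq AM≤m m≤BM sl with u , refl ← m≤n⇒∃[o]m+o≡n AM≤m
      with v , refl ← m≤n⇒∃[o]m+o≡n (+-cancelˡ-≤ (A * M) u M (≤-trans m≤BM (≤-reflexive (+-comm M (A * M))))) =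
      between i j u v eq sl

    -- The side to drop depends on `m`. Without sides B, an A is dropped throughout. Otherwise a B
    -- is dropped if `m` is at most the product of the other sides, or if some direction has B M ≤
    -- m; when all sides are B, `large-set` also covers the remaining sets.
    step : ∀ i j → i + j ≡ 2 + D → ∀ {m b} → Profile (suc D) m b → Bound m b i j
    step (suc i) zero eq {m} {b} P = from-A m b i 0 (Sum.[ low , high ]′ (≤-total m (Π i 0)))
      where
      eq′ : i ≡ suc D
      eq′ = trans (sym (+-identityʳ i)) (suc-injective eq)
      bound : ∀ {m b} → Profile D m b → Bound m b i 0
      bound = ih i 0 (suc-injective eq)
      low  = λ m≤Π → small-set D (Π i 0) (E i 0) bound A P m≤Π
        (≤-reflexive (trans (*-identityʳ (A ^ i)) (cong (A ^_) eq′)))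
      high = λ Π≤m → large-set D (Π i 0) (E i 0) bound A P Π≤m
        (subst (λ n → Π i 0 + A * E i 0 ≤ n * Π i 0) eq (E≤-A i 0))
    step i (suc j) eq {m} {b} P@(Ms , len , ∑≡ , slicings) = Sum.[ low , high i eq bound ]′ (≤-total m (Π i j))
      where
      eqB : ∀ i → i + suc j ≡ 2 + D → i + j ≡ suc D
      eqB i eq = suc-injective (trans (sym (+-suc i j)) eq)
      bound : ∀ {m b} → Profile D m b → Bound m b i j
      bound = ih i j (eqB i eq)
      low : m ≤ Π i j → Bound m b i (suc j)
      low m≤Π = from-B m b i j (small-set D (Π i j) (E i j) bound B P m≤Π
        (subst (λ n → Π i j ≤ B ^ n) (eqB i eq) (Π≤B^ i j)))
      high : ∀ i → i + suc j ≡ 2 + D → (∀ {m b} → Profile D m b → Bound m b i j) →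
        Π i j ≤ m → Bound m b i (suc j)
      high zero    eq bound Π≤m = from-B m b 0 j (large-set D (Π 0 j) (E 0 j) bound B P Π≤m
        (subst (λ n → Π 0 j + B * E 0 j ≤ n * Π 0 j) eq (E≤-B j)))
      high (suc i) eq bound Π≤m
        with ≤-splits {P = λ M → B * M ≤ m} {Q = λ M → m < B * M} {Ms} (λ M → ≤-<-connex (B * M) m)
      ... | inj₂ any with sl , BM≤m ← All.lookupAny slicings any =
        from-B m b (suc i) j (same-side-slicing D (Π (suc i) j) (E (suc i) j) bound B sl (inj₂ (BM≤m , Π≤m)))
      -- Now m < B M in every direction. If `m` is at least the product without one A, that A is
      -- dropped. Otherwise any single direction will do, and the first is taken: either m ≤ A M, or
      -- `m` lies between A M and B M and the concentration bound applies.
      ... | inj₁ all = Sum.[ narrow Ms len slicings all , wide ]′ (≤-total m (Π i (suc j)))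
        where
        boundA : ∀ {m b} → Profile D m b → Bound m b i (suc j)
        boundA = ih i (suc j) (suc-injective eq)
        narrow : ∀ Ms → length Ms ≡ suc D → All (λ M → Slicing (Profile D) M m b) Ms → All (λ M → m < B * M) Ms →
          m ≤ Π i (suc j) → Bound m b (suc i) (suc j)
        narrow (M ∷ _) _ (sl ∷ _) (m<BM ∷ _) m≤Π with ≤-total m (A * M)
        ... | inj₁ m≤AM = from-A m b i (suc j)
          (same-side-slicing D (Π i (suc j)) (E i (suc j)) boundA A sl (inj₁ (m≤AM , m≤Π)))
        ... | inj₂ AM≤m = between′ i j (eqB (suc i) eq) AM≤m (<⇒≤ m<BM) sl
        wide : Π i (suc j) ≤ m → Bound m b (suc i) (suc j)
        wide Π≤m = from-A m b i (suc j) (large-set D (Π i (suc j)) (E i (suc j)) boundA A P Π≤m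
          (subst (λ n → Π i (suc j) + A * E i (suc j) ≤ n * Π i (suc j)) eq (E≤-A i (suc j))))

  -- In dimension 0 there is one side, so E = 1 and the inequality follows from m ≤ m².
  tangent : ∀ D i j → i + j ≡ suc D → ∀ {m b} → Profile D m b → Bound m b i j
  tangent zero    (suc zero) zero       eq {m} {b} _ = ≤-trans (m*1≤m*m m) (m≤n+m (m * m) _)
    where
    unit : ∀ A → (1 + A * 0) * 1 + A * 1 * 0 ≡ 1
    unit = solve-∀
    m*1≤m*m : ∀ m → m * E 1 0 ≤ m * m
    m*1≤m*m zero    = z≤n
    m*1≤m*m (suc m) = *-monoʳ-≤ (suc m) (≤-trans (≤-reflexive (unit A)) (s≤s z≤n))
  tangent zero    zero       (suc zero) eq {m} {b} _ = ≤-trans (m*1≤m*m m) (m≤n+m (m * m) _)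
    where
    unit : ∀ B → 0 * (B * 1) + 1 * (1 + B * 0) ≡ 1
    unit = solve-∀
    m*1≤m*m : ∀ m → m * E 0 1 ≤ m * m
    m*1≤m*m zero    = z≤n
    m*1≤m*m (suc m) = *-monoʳ-≤ (suc m) (≤-trans (≤-reflexive (unit B)) (s≤s z≤n))
  tangent (suc D) i          j          eq P = Step.step D (tangent D) i j eq P

-- Lines and slices of point sets

module Fibres {X Y : Set} (_≟_ : DecidableEquality Y) (g : X → Y) where

  image : List X → List Y
  image xs = deduplicate _≟_ (map g xs)

  fibre : Y → List X → List X
  fibre y = filter (λ x → g x ≟ y)

  image! : ∀ xs → Unique (image xs)
  image! xs = deduplicate-! _≟_ (map g xs)

  ∈-image⁺ : ∀ {x xs} → x ∈ xs → g x ∈ image xs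
  ∈-image⁺ x∈ = ∈-deduplicate⁺ _≟_ (∈-map⁺ g x∈)

  ∈-image⁻ : ∀ {y} xs → y ∈ image xs → ∃[ x ] x ∈ xs × y ≡ g x
  ∈-image⁻ xs y∈ = ∈-map⁻ g (∈-deduplicate⁻ _≟_ (map g xs) y∈)

  ∈-fibre⁺ : ∀ {x y xs} → x ∈ xs → g x ≡ y → x ∈ fibre y xs
  ∈-fibre⁺ {y = y} = ∈-filter⁺ (λ x → g x ≟ y)

  ∈-fibre⁻ : ∀ {x y xs} → x ∈ fibre y xs → x ∈ xs × g x ≡ y
  ∈-fibre⁻ {y = y} = ∈-filter⁻ (λ x → g x ≟ y)

  private
    absent : ∀ x c {ys} → All (g x ≢_) ys → ∑ (λ y → 𝟙 (g x ≟ y) * c) ys ≡ 0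
    absent x c []                      = refl
    absent x c {y ∷ ys} (gx≢y ∷ gx∉ys) with g x ≟ y
    ... | yes gx≡y = contradiction gx≡y gx≢y
    ... | no  _    = absent x c gx∉ys

    present : ∀ x c {ys} → Unique ys → g x ∈ ys → ∑ (λ y → 𝟙 (g x ≟ y) * c) ys ≡ c
    present x c {y ∷ ys} (y∉ ∷ ys!) gx∈ with g x ≟ y | gx∈
    ... | yes refl | _         = trans (cong₂ _+_ (+-identityʳ c) (absent x c y∉)) (+-identityʳ c)
    ... | no  gx≢y | here gx≡y = contradiction gx≡y gx≢y
    ... | no  _    | there gx∈ = present x c ys! gx∈

  ∑-fibres : ∀ f {xs ys} → Unique ys → (∀ {x} → x ∈ xs → g x ∈ ys) →
    ∑ (λ y → ∑ f (fibre y xs)) ys ≡ ∑ f xs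
  ∑-fibres f {xs} {ys} ys! covers = begin
    ∑ (λ y → ∑ f (fibre y xs)) ys                   ≡⟨ ∑-cong ys (λ {y} _ → ∑-filter (λ x → g x ≟ y) f xs) ⟩
    ∑ (λ y → ∑ (λ x → 𝟙 (g x ≟ y) * f x) xs) ys     ≡⟨ ∑-swap (λ y x → 𝟙 (g x ≟ y) * f x) ys xs ⟩
    ∑ (λ x → ∑ (λ y → 𝟙 (g x ≟ y) * f x) ys) xs     ≡⟨ ∑-cong xs (λ {x} x∈ → present x (f x) ys! (covers x∈)) ⟩
    ∑ f xs                                          ∎
    where open ≡-Reasoning

  length-fibres : ∀ {xs ys} → Unique ys → (∀ {x} → x ∈ xs → g x ∈ ys) →
    ∑ (λ y → length (fibre y xs)) ys ≡ length xs
  length-fibres {xs} {ys} ys! covers = trans (∑-cong ys (λ {y} _ → sym (∑-one (fibre y xs))))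
    (trans (∑-fibres (λ _ → 1) ys! covers) (∑-one xs))

module _ {d : ℕ} where

  -- The line through x in direction e i, represented by its point in the i-th
  -- coordinate hyperplane.
  line : Fin d → ℤ^ d → ℤ^ d
  line i x = x [ i ]≔ 0ℤ

  module Lines  (i : Fin d) = Fibres _≟_ (line i)
  module Levels (i : Fin d) = Fibres ℤ._≟_ (λ (x : ℤ^ d) → lookup x i)

  lines : Fin d → List (ℤ^ d) → List (ℤ^ d)
  lines = Lines.image

  levels : Fin d → List (ℤ^ d) → List ℤ
  levels = Levels.image

  slice : Fin d → ℤ → List (ℤ^ d) → List (ℤ^ d)
  slice = Levels.fibre

  projections : List (Fin d) → List (ℤ^ d) → ℕ
  projections J T = ∑ (λ i → length (lines i T)) J

line-injective : ∀ {d} i {x y : ℤ^ d} → line i x ≡ line i y → lookup x i ≡ lookup y i → x ≡ y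
line-injective zero    {a ∷ x} {b ∷ y} eq refl = cong (a ∷_) (cong Vec.tail eq)
line-injective (suc i) {a ∷ x} {b ∷ y} eq eq′  =
  cong₂ _∷_ (cong Vec.head eq) (line-injective i (cong Vec.tail eq) eq′)

module _ {d : ℕ} {T : List (ℤ^ d)} (T! : Unique T) where

  slice! : ∀ i t → Unique (slice i t T)
  slice! i t = Unique.filter⁺ (λ x → lookup x i ℤ.≟ t) T!

  slice-lines-≤ : ∀ i t → length (slice i t T) ≤ length (lines i T)
  slice-lines-≤ i t = length-injection (line i) (slice! i t)
    (λ x∈ y∈ eq → line-injective i eq (trans (level x∈) (sym (level y∈))))
    (λ x∈ → Lines.∈-image⁺ i (proj₁ (Levels.∈-fibre⁻ i {xs = T} x∈)))
    where
    level : ∀ {x} → x ∈ slice i t T → lookup x i ≡ t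
    level x∈ = proj₂ (Levels.∈-fibre⁻ i {xs = T} x∈)

-- Moving in direction `k` preserves the coordinate `i`, so the lines of the slice at `t` are among
-- the members of `lines k T` at level `t`, and different slices share none.
lines-slices-≤ : ∀ {d} {i k : Fin d} → i ≢ k → ∀ T →
  ∑ (λ t → length (lines k (slice i t T))) (levels i T) ≤ length (lines k T)
lines-slices-≤ {i = i} {k} i≢k T = begin
  ∑ (λ t → length (lines k (slice i t T))) (levels i T)
    ≤⟨ ∑-mono (levels i T) (λ {t} _ → length-⊆ (Lines.image! k (slice i t T)) (into t)) ⟩
  ∑ (λ t → length (slice i t (lines k T))) (levels i T)
    ≡⟨ Levels.length-fibres i (Levels.image! i T) covers ⟩
  length (lines k T) ∎
  where
  open ≤-Reasoning
  into : ∀ t {y} → y ∈ lines k (slice i t T) → y ∈ slice i t (lines k T)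
  into t y∈ with x , x∈ , refl ← Lines.∈-image⁻ k (slice i t T) y∈ with x∈T , refl ← Levels.∈-fibre⁻ i {xs = T} x∈ =
    Levels.∈-fibre⁺ i (Lines.∈-image⁺ k x∈T) (lookup∘update′ i≢k x 0ℤ)
  covers : ∀ {y} → y ∈ lines k T → lookup y i ∈ levels i T
  covers y∈ with x , x∈T , refl ← Lines.∈-image⁻ k T y∈ =
    subst (_∈ levels i T) (sym (lookup∘update′ i≢k x 0ℤ)) (Levels.∈-image⁺ i x∈T)

projections-slices-≤ : ∀ {d} {i : Fin d} {J} → All (i ≢_) J → ∀ T →
  ∑ (λ t → projections J (slice i t T)) (levels i T) ≤ projections J T
projections-slices-≤ {i = i} {J} i∉J T = ≤-trans
  (≤-reflexive (∑-swap (λ t k → length (lines k (slice i t T))) (levels i T) J))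
  (∑-mono J (λ k∈J → lines-slices-≤ (All.lookup i∉J k∈J) T))

-- Slices remain in ℤ^d; what decreases is the list `J` of available directions, from which the
-- slicing direction is removed.
profile : ∀ {d} (J : List (Fin d)) D → length J ≡ D → Unique J → ∀ {T} → Unique T →
  Profile D (length T) (projections J T)
profile J zero    _   _  _      = tt
profile J (suc D) len J! {T} T! = map (λ i → length (lines i T)) J , trans (length-map _ J) len , refl ,
  All.map⁺ (All.tabulate slicing)
  where
  slicing : ∀ {i} → i ∈ J → Slicing (Profile D) (length (lines i T)) (length T) (projections J T)
  slicing {i} i∈J with J′ , p ← extract i∈J with i∉J′ ∷ J′! ← Unique-resp-↭ p J! =
    map sizes (levels i T) ,
    All.map⁺ (All.tabulate (λ {t} _ → slice-lines-≤ T! i t ,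
      profile J′ D (suc-injective (trans (sym (↭-length p)) len)) J′! (slice! T! i t))) ,
    trans (∑-map proj₁ sizes (levels i T)) (Levels.length-fibres i (Levels.image! i T) (Levels.∈-image⁺ i)) ,
    (begin
      length (lines i T) + ∑ proj₂ (map sizes (levels i T))
        ≡⟨ cong (length (lines i T) +_) (∑-map proj₂ sizes (levels i T)) ⟩
      length (lines i T) + ∑ (λ t → projections J′ (slice i t T)) (levels i T)
        ≤⟨ +-monoʳ-≤ (length (lines i T)) (projections-slices-≤ i∉J′ T) ⟩
      projections (i ∷ J′) T
        ≡⟨ ∑-↭ (λ i → length (lines i T)) p ⟨
      projections J T ∎)
    where
    open ≤-Reasoning
    sizes : ℤ → ℕ × ℕ
    sizes t = length (slice i t T) , projections J′ (slice i t T)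

-- The edge boundary

highest : ∀ (f : X → ℤ) {x xs} → x ∈ xs → ∃[ u ] u ∈ xs × (∀ {z} → z ∈ xs → f z ℤ.≤ f u)
highest f {xs = x ∷ []}     _ = x , here refl , λ { (here refl) → ℤ.≤-refl }
highest f {xs = x ∷ y ∷ xs} _ with u , u∈ , u≥ ← highest f {xs = y ∷ xs} (here refl)
  with ℤ.≤-total (f u) (f x)
... | inj₁ fu≤fx = x , here refl , λ { (here refl) → ℤ.≤-refl ; (there z∈) → ℤ.≤-trans (u≥ z∈) fu≤fx }
... | inj₂ fx≤fu = u , there u∈  , λ { (here refl) → fx≤fu ; (there z∈) → u≥ z∈ }

⊹-0 : ∀ {d} (x : ℤ^ d) → x ⊹ replicate d 0ℤ ≡ x
⊹-0 = zipWith-identityʳ ℤ.+-identityʳ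

⊹-⊝ : ∀ {d} (x g : ℤ^ d) → x ⊹ g ⊹ ⊝ g ≡ x
⊹-⊝ []      []      = refl
⊹-⊝ (a ∷ x) (b ∷ g) = cong₂ _∷_
  (trans (ℤ.+-assoc a b (ℤ.- b)) (trans (cong (λ z → a ℤ.+ z) (ℤ.+-inverseʳ b)) (ℤ.+-identityʳ a))) (⊹-⊝ x g)

⊝-⊹ : ∀ {d} (x g : ℤ^ d) → x ⊹ ⊝ g ⊹ g ≡ x
⊝-⊹ []      []      = refl
⊝-⊹ (a ∷ x) (b ∷ g) = cong₂ _∷_
  (trans (ℤ.+-assoc a (ℤ.- b) b) (trans (cong (λ z → a ℤ.+ z) (ℤ.+-inverseˡ b)) (ℤ.+-identityʳ a))) (⊝-⊹ x g)

⊹-2e : ∀ {d} (i : Fin d) x → x ⊹ ℤ.+ 2 · e i ≡ x ⊹ e i ⊹ e i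
⊹-2e {suc d} zero (a ∷ x) = cong₂ _∷_ (sym (ℤ.+-assoc a 1ℤ 1ℤ)) (begin
  x ⊹ ℤ.+ 2 · replicate d 0ℤ           ≡⟨ cong (x ⊹_) (map-replicate (λ z → ℤ.+ 2 ℤ.* z) 0ℤ d) ⟩
  x ⊹ replicate d 0ℤ                   ≡⟨ ⊹-0 (x ⊹ replicate d 0ℤ) ⟨
  x ⊹ replicate d 0ℤ ⊹ replicate d 0ℤ  ∎)
  where open ≡-Reasoning
⊹-2e (suc i) (a ∷ x) = cong₂ _∷_ (sym (ℤ.+-identityʳ (a ℤ.+ 0ℤ))) (⊹-2e i x)

line-⊹e : ∀ {d} (i : Fin d) x → line i (x ⊹ e i) ≡ line i x
line-⊹e zero    (a ∷ x) = cong (0ℤ ∷_) (⊹-0 x)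
line-⊹e (suc i) (a ∷ x) = cong₂ _∷_ (ℤ.+-identityʳ a) (line-⊹e i x)

height-⊹e : ∀ {d} (i : Fin d) x → lookup x i ℤ.< lookup (x ⊹ e i) i
height-⊹e {d} i x rewrite lookup-zipWith ℤ._+_ i x (e i) | lookup∘update i (replicate d 0ℤ) 1ℤ =
  subst (ℤ._< lookup x i ℤ.+ 1ℤ) (ℤ.+-identityʳ (lookup x i))
    (ℤ.+-monoʳ-< (lookup x i) (ℤ.+<+ (s≤s z≤n)))

line-⊹2e : ∀ {d} (i : Fin d) x → line i (x ⊹ ℤ.+ 2 · e i) ≡ line i x
line-⊹2e i x rewrite ⊹-2e i x = trans (line-⊹e i (x ⊹ e i)) (line-⊹e i x)

height-⊹2e : ∀ {d} (i : Fin d) x → lookup x i ℤ.< lookup (x ⊹ ℤ.+ 2 · e i) i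
height-⊹2e i x rewrite ⊹-2e i x = ℤ.<-trans (height-⊹e i x) (height-⊹e i (x ⊹ e i))

module _ {d : ℕ} where
  open DecMembership (_≟_ {d}) using (_∈?_)

  exits? : ∀ (S : List (ℤ^ d)) (g u : ℤ^ d) → Dec ((u ⊹ g) ∉ S)
  exits? S g u = ¬? ((u ⊹ g) ∈? S)

  out : List (ℤ^ d) → ℤ^ d → ℕ
  out S g = ∑ (𝟙 ∘ exits? S g) S

  ∂≡∑out : ∀ U S → Cayley.∂ U S ≡ ∑ (out S) U
  ∂≡∑out U S = begin
    Cayley.∂ U S
      ≡⟨ length-filter-𝟙 (λ (_ , v) → ¬? (v ∈? S)) (cartesianProductWith (λ u g → u , u ⊹ g) S U) ⟩
    ∑ (λ (_ , v) → 𝟙 (¬? (v ∈? S))) (cartesianProductWith (λ u g → u , u ⊹ g) S U)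
      ≡⟨ ∑-cartesianProductWith _ (λ u g → u , u ⊹ g) S U ⟩
    ∑ (λ u → ∑ (λ g → 𝟙 (exits? S g u)) U) S ≡⟨ ∑-swap (λ u g → 𝟙 (exits? S g u)) S U ⟩
    ∑ (out S) U                                      ∎
    where open ≡-Reasoning

  module _ {S : List (ℤ^ d)} (S! : Unique S) where

    stays : ℤ^ d → List (ℤ^ d)
    stays g = filter (λ u → (u ⊹ g) ∈? S) S

    stays-≤ : ∀ g g′ → (∀ u → u ⊹ g ⊹ g′ ≡ u) → length (stays g) ≤ length (stays g′)
    stays-≤ g g′ back = length-injection (_⊹ g) (Unique.filter⁺ _ S!)
      (λ {x} {y} _ _ eq → trans (sym (back x)) (trans (cong (_⊹ g′) eq) (back y))) into
      where
      into : ∀ {u} → u ∈ stays g → (u ⊹ g) ∈ stays g′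
      into {u} u∈ with u∈S , u+g∈S ← ∈-filter⁻ (λ u → (u ⊹ g) ∈? S) u∈ =
        ∈-filter⁺ (λ u → (u ⊹ g′) ∈? S) u+g∈S (subst (_∈ S) (sym (back u)) u∈S)

    stays+out : ∀ g → length (stays g) + out S g ≡ length S
    stays+out g = trans (cong (length (stays g) +_) (sym (length-filter-𝟙 (exits? S g) S)))
      (length-split (λ u → (u ⊹ g) ∈? S) S)

    -- Translation by `g` is a bijection from the points that stay in `S` under `g` to those that
    -- stay under `⊝ g`; the exits are the complements.
    out-⊝ : ∀ g → out S (⊝ g) ≡ out S g
    out-⊝ g = +-cancelˡ-≡ (length (stays g)) _ _ (begin
      length (stays g) + out S (⊝ g)     ≡⟨ cong (_+ out S (⊝ g)) stays-⊝ ⟩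
      length (stays (⊝ g)) + out S (⊝ g) ≡⟨ stays+out (⊝ g) ⟩
      length S                           ≡⟨ stays+out g ⟨
      length (stays g) + out S g         ∎)
      where
      open ≡-Reasoning
      stays-⊝ : length (stays g) ≡ length (stays (⊝ g))
      stays-⊝ = ≤-antisym (stays-≤ g (⊝ g) (λ u → ⊹-⊝ u g)) (stays-≤ (⊝ g) g (λ u → ⊝-⊹ u g))

  halfCost : 2 ≤ d → List (ℤ^ d) → ℕ
  halfCost 2≤d S = ∑ (out S) (halfGenerators 2≤d)

  ∂≡2*halfCost : ∀ (2≤d : 2 ≤ d) {S} → Unique S → Cayley.∂ (generators 2≤d) S ≡ 2 * halfCost 2≤d S
  ∂≡2*halfCost 2≤d {S} S! = begin
    Cayley.∂ (generators 2≤d) S       ≡⟨ ∂≡∑out (generators 2≤d) S ⟩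
    ∑ (out S) (H ++ map ⊝_ H)         ≡⟨ ∑-++ (out S) H (map ⊝_ H) ⟩
    ∑ (out S) H + ∑ (out S) (map ⊝_ H) ≡⟨ cong (∑ (out S) H +_) (∑-map (out S) ⊝_ H) ⟩
    ∑ (out S) H + ∑ (out S ∘ ⊝_) H    ≡⟨ cong (∑ (out S) H +_) (∑-cong H (λ {g} _ → out-⊝ S! g)) ⟩
    ∑ (out S) H + ∑ (out S) H         ≡⟨ cong (∑ (out S) H +_) (+-identityʳ _) ⟨
    2 * ∑ (out S) H                   ∎
    where
    open ≡-Reasoning
    H = halfGenerators 2≤d

  module _ (S : List (ℤ^ d)) (i : Fin d) where

    highest-exits : ∀ g y {u} → line i (u ⊹ g) ≡ line i u → lookup u i ℤ.< lookup (u ⊹ g) i →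
      (∀ {z} → z ∈ Lines.fibre i y S → lookup z i ℤ.≤ lookup u i) → line i u ≡ y → (u ⊹ g) ∉ S
    highest-exits g y along up u≥ u∈y u+g∈S =
      ℤ.<⇒≱ up (u≥ (Lines.∈-fibre⁺ i u+g∈S (trans along u∈y)))

    line-out : ∀ {y} → y ∈ lines i S → 1 ≤ ∑ (𝟙 ∘ exits? S (e i)) (Lines.fibre i y S)
    line-out {y} y∈ with x , x∈S , y≡ ← Lines.∈-image⁻ i S y∈
      with u , u∈ , u≥ ← highest (λ z → lookup z i) {xs = Lines.fibre i y S} (Lines.∈-fibre⁺ i x∈S (sym y≡)) =
      ≤-trans (𝟙-yes (exits? S (e i) u) (highest-exits (e i) y (line-⊹e i u) (height-⊹e i u) u≥
                (proj₂ (Lines.∈-fibre⁻ i {xs = S} u∈))))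
              (≤∑ (𝟙 ∘ exits? S (e i)) u∈)

    lines≤out : length (lines i S) ≤ out S (e i)
    lines≤out = begin
      length (lines i S)                 ≡⟨ ∑-one (lines i S) ⟨
      ∑ (λ _ → 1) (lines i S)            ≤⟨ ∑-mono (lines i S) line-out ⟩
      ∑ (λ y → ∑ (𝟙 ∘ exits? S (e i)) (Lines.fibre i y S)) (lines i S)
        ≡⟨ Lines.∑-fibres i (𝟙 ∘ exits? S (e i)) (Lines.image! i S) (Lines.∈-image⁺ i) ⟩
      out S (e i)                        ∎
      where open ≤-Reasoning

    exits₁₂ : ℤ^ d → ℕ
    exits₁₂ u = 𝟙 (exits? S (e i) u) + 𝟙 (exits? S (ℤ.+ 2 · e i) u)

    highest-exits₁₂ : ∀ {y u} → (∀ {z} → z ∈ Lines.fibre i y S → lookup z i ℤ.≤ lookup u i) → line i u ≡ y →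
      2 ≤ exits₁₂ u
    highest-exits₁₂ {y} {u} u≥ u∈y = +-mono-≤
      (𝟙-yes (exits? S (e i) u) (highest-exits (e i) y (line-⊹e i u) (height-⊹e i u) u≥ u∈y))
      (𝟙-yes (exits? S (ℤ.+ 2 · e i) u)
        (highest-exits (ℤ.+ 2 · e i) y (line-⊹2e i u) (height-⊹2e i u) u≥ u∈y))

    line-out₁₂ : ∀ {y} → y ∈ lines i S → 2 ≤ ∑ exits₁₂ (Lines.fibre i y S)
    line-out₁₂ {y} y∈ with x , x∈S , y≡ ← Lines.∈-image⁻ i S y∈
      with u , u∈ , u≥ ← highest (λ z → lookup z i) {xs = Lines.fibre i y S} (Lines.∈-fibre⁺ i x∈S (sym y≡)) =
      ≤-trans (highest-exits₁₂ u≥ (proj₂ (Lines.∈-fibre⁻ i {xs = S} u∈))) (≤∑ exits₁₂ u∈)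

    -- The second highest point u′ contributes a third edge: if u′ + e i is in S
    -- it is the highest point, so u′ + 2 e i is not in S.
    long-line-out₁₂ : ∀ {y} → 2 ≤ length (Lines.fibre i y S) → 3 ≤ ∑ exits₁₂ (Lines.fibre i y S)
    long-line-out₁₂ {y} 2≤len = go (Lines.fibre i y S) refl 2≤len
      where
      open ≤-Reasoning
      go : ∀ F → F ≡ Lines.fibre i y S → 2 ≤ length F → 3 ≤ ∑ exits₁₂ F
      go F@(_ ∷ _) F≡ 2≤ with u , u∈ , u≥ ← highest (λ z → lookup z i) {xs = F} (here refl)
        with extract u∈
      ... | [] , p = contradiction (subst (2 ≤_) (↭-length p) 2≤) λ { (s≤s ()) }
      ... | F′@(_ ∷ _) , p with u′ , u′∈ , u′≥ ← highest (λ z → lookup z i) {xs = F′} (here refl) = begin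
        2 + 1                        ≤⟨ +-mono-≤ (highest-exits₁₂ (λ z∈ → u≥ (subst (_ ∈_) (sym F≡) z∈)) (on-line u∈)) second ⟩
        exits₁₂ u + ∑ exits₁₂ F′     ≡⟨ ∑-↭ exits₁₂ p ⟨
        ∑ exits₁₂ F                  ∎
        where
        on-line : ∀ {z} → z ∈ F → line i z ≡ y
        on-line z∈ = proj₂ (Lines.∈-fibre⁻ i {xs = S} (subst (_ ∈_) F≡ z∈))
        u′∈F : u′ ∈ F
        u′∈F = ∈-resp-↭ (↭-sym p) (there u′∈)
        next : (u′ ⊹ e i) ∈ S → u′ ⊹ e i ≡ u
        next u′+e∈S with ∈-resp-↭ p (subst (_ ∈_) (sym F≡)
                          (Lines.∈-fibre⁺ i u′+e∈S (trans (line-⊹e i u′) (on-line u′∈F))))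
        ... | here eq      = eq
        ... | there u′+e∈F′ = contradiction (u′≥ u′+e∈F′) (ℤ.<⇒≱ (height-⊹e i u′))
        second′ : 1 ≤ exits₁₂ u′
        second′ with (u′ ⊹ e i) ∈? S
        ... | no  _      = s≤s z≤n
        ... | yes u′+e∈S = 𝟙-yes (exits? S (ℤ.+ 2 · e i) u′) (subst (_∉ S)
            (sym (trans (⊹-2e i u′) (cong (_⊹ e i) (next u′+e∈S))))
            (highest-exits (e i) y (line-⊹e i u) (height-⊹e i u) (λ z∈ → u≥ (subst (_ ∈_) (sym F≡) z∈)) (on-line u∈)))
        second : 1 ≤ ∑ exits₁₂ F′
        second = ≤-trans second′ (≤∑ exits₁₂ u′∈)

-- The layers of a set along e₁

at-most-one : ∀ {x y : X} {xs} → length xs ≤ 1 → x ∈ xs → y ∈ xs → x ≡ y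
at-most-one {xs = _ ∷ []} _ (here refl) (here refl) = refl
at-most-one {xs = _ ∷ _ ∷ _} (s≤s ()) _ _

-- The slices t ∈ V of a set of n points: slice t has m t points, m t ≤ r + κ t
-- of which at most κ t are the only point of their line in the first direction;
-- r and k count the lines with several points and with one point.
record Layers (D n h : ℕ) (V : List ℤ) : Set where
  field
    r k         : ℕ
    m κ b       : ℤ → ℕ
    total       : ∑ m V ≡ n
    inhabited   : ∀ {t} → t ∈ V → 1 ≤ m t
    m≤r+κ       : ∀ t → m t ≤ r + κ t
    ∑κ≤k        : ∑ κ V ≤ k
    cost        : 3 * r + 2 * k + ∑ b V ≤ h
    profiles    : ∀ t → Profile D (m t) (b t)

module _ {D : ℕ} (S : List (ℤ^ (suc D))) (S! : Unique S) where

  private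
    J : List (Fin (suc D))
    J = tabulate suc

    J! : Unique J
    J! = Unique.tabulate⁺ (λ { refl → refl })

    V = levels zero S
    Ls = lines zero S

    onLine : ℤ^ (suc D) → List (ℤ^ (suc D))
    onLine y = Lines.fibre zero y S

    Several : ℤ^ (suc D) → Set
    Several y = 2 ≤ length (onLine y)

    several? : Decidable Several
    several? y = 2 ≤? length (onLine y)

    isolated? : Decidable (λ x → ¬ Several (line zero x))
    isolated? x = ¬? (several? (line zero x))

    layer : ℤ → List (ℤ^ (suc D))
    layer t = slice zero t S

    r = length (filter several? Ls)
    k = length (filter (¬? ∘ several?) Ls)
    κ = λ t → length (filter isolated? (layer t))

    layer⊆ : ∀ {t x} → x ∈ layer t → x ∈ S
    layer⊆ x∈ = proj₁ (Levels.∈-fibre⁻ zero {xs = S} x∈)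

    layer-level : ∀ {t x} → x ∈ layer t → lookup x zero ≡ t
    layer-level x∈ = proj₂ (Levels.∈-fibre⁻ zero {xs = S} x∈)

    -- Within a layer a point is determined by its line, so the points that are not isolated inject
    -- into the `r` lines with several points.
    layer-size : ∀ t → length (layer t) ≤ r + κ t
    layer-size t = begin
      length (layer t)             ≡⟨ length-split (several? ∘ line zero) (layer t) ⟨
      length (filter (several? ∘ line zero) (layer t)) + κ t ≤⟨ +-monoˡ-≤ (κ t) to-lines ⟩
      r + κ t                      ∎
      where
      open ≤-Reasoning
      member : ∀ {x} → x ∈ filter (several? ∘ line zero) (layer t) → x ∈ layer t × Several (line zero x)
      member = ∈-filter⁻ (several? ∘ line zero)
      to-lines : length (filter (several? ∘ line zero) (layer t)) ≤ r
      to-lines = length-injection (line zero) (Unique.filter⁺ _ (slice! S! zero t))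
        (λ x∈ y∈ eq → line-injective zero eq
          (trans (layer-level (proj₁ (member x∈))) (sym (layer-level (proj₁ (member y∈))))))
        (λ x∈ → ∈-filter⁺ several? (Lines.∈-image⁺ zero (layer⊆ (proj₁ (member x∈)))) (proj₂ (member x∈)))

    isolated-points : ∑ κ V ≤ k
    isolated-points = begin
      ∑ κ V                                       ≡⟨ ∑-cong V (λ {t} _ → length-filter-𝟙 isolated? (layer t)) ⟩
      ∑ (λ t → ∑ (𝟙 ∘ isolated?) (layer t)) V     ≡⟨ Levels.∑-fibres zero (𝟙 ∘ isolated?) (Levels.image! zero S) (Levels.∈-image⁺ zero) ⟩
      ∑ (𝟙 ∘ isolated?) S                         ≡⟨ length-filter-𝟙 isolated? S ⟨
      length (filter isolated? S)                 ≤⟨ length-injection (line zero) (Unique.filter⁺ _ S!) alone into ⟩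
      k                                           ∎
      where
      open ≤-Reasoning
      alone : ∀ {x y} → x ∈ filter isolated? S → y ∈ filter isolated? S → line zero x ≡ line zero y → x ≡ y
      alone {x} {y} x∈ y∈ eq with x∈S , x-isolated ← ∈-filter⁻ isolated? {xs = S} x∈ =
        at-most-one (s≤s⁻¹ (≰⇒> x-isolated)) (Lines.∈-fibre⁺ zero x∈S refl)
          (Lines.∈-fibre⁺ zero (proj₁ (∈-filter⁻ isolated? {xs = S} y∈)) (sym eq))
      into : ∀ {x} → x ∈ filter isolated? S → line zero x ∈ filter (¬? ∘ several?) Ls
      into x∈ with x∈S , x-isolated ← ∈-filter⁻ isolated? {xs = S} x∈ =
        ∈-filter⁺ (¬? ∘ several?) (Lines.∈-image⁺ zero x∈S) x-isolated

    line-cost : ∀ {y} → y ∈ Ls → 3 * 𝟙 (several? y) + 2 * 𝟙 (¬? (several? y)) ≤ ∑ (exits₁₂ S zero) (onLine y)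
    line-cost {y} y∈ with several? y
    ... | yes several = long-line-out₁₂ S zero several
    ... | no  _       = line-out₁₂ S zero y∈

    lines-cost : 3 * r + 2 * k ≤ out S (e zero) + out S (ℤ.+ 2 · e zero)
    lines-cost = begin
      3 * r + 2 * k
        ≡⟨ cong₂ (λ x y → 3 * x + 2 * y) (length-filter-𝟙 several? Ls) (length-filter-𝟙 (¬? ∘ several?) Ls) ⟩
      3 * ∑ (𝟙 ∘ several?) Ls + 2 * ∑ (𝟙 ∘ ¬? ∘ several?) Ls
        ≡⟨ cong₂ _+_ (*-∑ 3 (𝟙 ∘ several?) Ls) (*-∑ 2 (𝟙 ∘ ¬? ∘ several?) Ls) ⟩
      ∑ (λ y → 3 * 𝟙 (several? y)) Ls + ∑ (λ y → 2 * 𝟙 (¬? (several? y))) Ls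
        ≡⟨ ∑-+ (λ y → 3 * 𝟙 (several? y)) (λ y → 2 * 𝟙 (¬? (several? y))) Ls ⟨
      ∑ (λ y → 3 * 𝟙 (several? y) + 2 * 𝟙 (¬? (several? y))) Ls ≤⟨ ∑-mono Ls line-cost ⟩
      ∑ (λ y → ∑ (exits₁₂ S zero) (onLine y)) Ls
        ≡⟨ Lines.∑-fibres zero (exits₁₂ S zero) (Lines.image! zero S) (Lines.∈-image⁺ zero) ⟩
      ∑ (exits₁₂ S zero) S
        ≡⟨ ∑-+ (𝟙 ∘ exits? S (e zero)) (𝟙 ∘ exits? S (ℤ.+ 2 · e zero)) S ⟩
      out S (e zero) + out S (ℤ.+ 2 · e zero) ∎
      where open ≤-Reasoning

    projections-cost : ∑ (λ t → projections J (layer t)) V ≤ ∑ (out S) (map e J)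
    projections-cost = begin
      ∑ (λ t → projections J (layer t)) V  ≤⟨ projections-slices-≤ {i = zero} {J} (All.tabulate⁺ {f = suc} (λ _ ())) S ⟩
      projections J S                      ≤⟨ ∑-mono J (λ {i} _ → lines≤out S i) ⟩
      ∑ (out S ∘ e) J                      ≡⟨ ∑-map (out S) e J ⟨
      ∑ (out S) (map e J)                  ∎
      where open ≤-Reasoning

  layers : ∀ (2≤d : 2 ≤ suc D) → Layers D (length S) (halfCost 2≤d S) (levels zero S)
  layers (s≤s _) = record
    { r         = r
    ; k         = k
    ; m         = λ t → length (layer t)
    ; κ         = κ
    ; b         = λ t → projections J (layer t)
    ; total     = Levels.length-fibres zero (Levels.image! zero S) (Levels.∈-image⁺ zero)
    ; inhabited = inhabited
    ; m≤r+κ     = layer-size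
    ; ∑κ≤k      = isolated-points
    ; cost      = ≤-trans (+-mono-≤ lines-cost projections-cost) (≤-reflexive (reassociate (out S (e zero)) _ _))
    ; profiles  = λ t → profile J D (length-tabulate suc) J! (slice! S! zero t)
    }
    where
    reassociate : ∀ x y z → x + y + z ≡ y + (x + z)
    reassociate = solve-∀
    inhabited : ∀ {t} → t ∈ V → 1 ≤ length (layer t)
    inhabited {t} t∈ with x , x∈S , refl ← Levels.∈-image⁻ zero S t∈ = ∈-length (Levels.∈-fibre⁺ zero x∈S refl)

-- The energy inequality for layers

module Energy {D n h V} (L : Layers D n h V) (A₀ i j : ℕ) (i+j≡ : i + j ≡ suc D) where
  open Layers L
  open Tangent A₀

  M : ℕ
  M = r + k

  ∑sq : ℕ
  ∑sq = ∑ (sq ∘ m) V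

  layers-bound : n * E i j ≤ ∑ b V * Π i j + ∑sq
  layers-bound = subst (λ n → n * E i j ≤ ∑ b V * Π i j + ∑sq) total (go V)
    where
    eq : ∀ a b c d → a + b + (c + d) ≡ a + c + (b + d)
    eq = solve-∀
    go : ∀ V → ∑ m V * E i j ≤ ∑ b V * Π i j + ∑ (sq ∘ m) V
    go []      = z≤n
    go (t ∷ V) rewrite *-distribʳ-+ (E i j) (m t) (∑ m V) | *-distribʳ-+ (Π i j) (b t) (∑ b V) =
      ≤-trans (+-mono-≤ (tangent D i j i+j≡ (profiles t)) (go V)) (≤-reflexive (eq (b t * Π i j) (sq (m t)) _ _))

  m≤M : ∀ {t} → t ∈ V → m t ≤ M
  m≤M {t} t∈ = ≤-trans (m≤r+κ t) (+-monoʳ-≤ r (≤-trans (≤∑ κ t∈) ∑κ≤k))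

  -- In (m t)² one factor is bounded by r + κ t, and only next to κ t is the other bounded by `M`.
  -- The result is n M - (n - M) k, a saving over n M for each line with a single point.
  ∑sq≤ : ∑sq ≤ n * r + M * k
  ∑sq≤ = begin
    ∑sq                                ≤⟨ ∑-mono V (λ {t} t∈ → term t t∈) ⟩
    ∑ (λ t → m t * r + M * κ t) V      ≡⟨ linear V ⟩
    ∑ m V * r + M * ∑ κ V              ≤⟨ +-mono-≤ (≤-reflexive (cong (_* r) total)) (*-monoʳ-≤ M ∑κ≤k) ⟩
    n * r + M * k                      ∎
    where
    open ≤-Reasoning
    term : ∀ t → t ∈ V → sq (m t) ≤ m t * r + M * κ t
    term t t∈ = begin
      m t * m t             ≤⟨ *-monoʳ-≤ (m t) (m≤r+κ t) ⟩
      m t * (r + κ t)       ≡⟨ *-distribˡ-+ (m t) r (κ t) ⟩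
      m t * r + m t * κ t   ≤⟨ +-monoʳ-≤ (m t * r) (*-monoˡ-≤ (κ t) (m≤M t∈)) ⟩
      m t * r + M * κ t     ∎
    eq : ∀ a r K b c d → a * r + K * b + (c * r + K * d) ≡ (a + c) * r + K * (b + d)
    eq = solve-∀
    linear : ∀ V → ∑ (λ t → m t * r + M * κ t) V ≡ ∑ m V * r + M * ∑ κ V
    linear []      = sym (*-zeroʳ M)
    linear (t ∷ V) rewrite linear V = eq (m t) r M (κ t) _ _

  -- Each line with a single point is cheaper by one than the other lines, hence
  -- the term k Π.
  energy : n * E i j + 3 * (Π i j * M) ≤ h * Π i j + k * Π i j + ∑sq
  energy = begin
    n * E i j + 3 * (Π i j * M)                              ≤⟨ +-monoˡ-≤ _ layers-bound ⟩
    ∑ b V * Π i j + ∑sq + 3 * (Π i j * M)                    ≡⟨ eq (∑ b V) (Π i j) ∑sq r k ⟩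
    (3 * r + 2 * k + ∑ b V) * Π i j + k * Π i j + ∑sq        ≤⟨ +-monoˡ-≤ ∑sq (+-monoˡ-≤ _ (*-monoˡ-≤ (Π i j) cost)) ⟩
    h * Π i j + k * Π i j + ∑sq                              ∎
    where
    open ≤-Reasoning
    eq : ∀ b p s r k → b * p + s + 3 * (p * (r + k)) ≡ (3 * r + 2 * k + b) * p + k * p + s
    eq = solve-∀

  -- The saving (n - M) k in `∑sq≤` pays for the surcharge k Π in `energy`, so lines with a single
  -- point do no harm.
  energy-M : M + Π i j ≤ n → n * E i j + 3 * (Π i j * M) ≤ h * Π i j + n * M
  energy-M M+Π≤n = +-cancelʳ-≤ (k * (M + Π i j)) _ _ (begin
    n * E i j + 3 * (Π i j * M) + k * (M + Π i j)
      ≤⟨ +-monoˡ-≤ _ (≤-trans energy (+-monoʳ-≤ _ ∑sq≤)) ⟩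
    h * Π i j + k * Π i j + (n * r + M * k) + k * (M + Π i j)
      ≤⟨ +-monoʳ-≤ (h * Π i j + k * Π i j + (n * r + M * k)) (*-monoʳ-≤ k M+Π≤n) ⟩
    h * Π i j + k * Π i j + (n * r + M * k) + k * n      ≡⟨ eq (h * Π i j) k (Π i j) n r M ⟩
    h * Π i j + n * (r + k) + k * (M + Π i j)            ∎)
    where
    open ≤-Reasoning
    eq : ∀ x k p n r M → x + k * p + (n * r + M * k) + k * n ≡ x + n * (r + k) + k * (M + p)
    eq = solve-∀

  -- A crude a priori bound on `M`, from which the hypothesis of `energy-M` is checked at the two
  -- sizes.
  2M≤h : 2 * M ≤ h
  2M≤h = begin
    2 * M                     ≤⟨ m≤m+n (2 * M) (r + ∑ b V) ⟩
    2 * M + (r + ∑ b V)       ≡⟨ eq r k (∑ b V) ⟩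
    3 * r + 2 * k + ∑ b V     ≤⟨ cost ⟩
    h                         ∎
    where
    open ≤-Reasoning
    eq : ∀ r k b → 2 * (r + k) + (r + b) ≡ 3 * r + 2 * k + b
    eq = solve-∀

  n≤∣V∣*M : n ≤ length V * M
  n≤∣V∣*M = begin
    n                 ≡⟨ total ⟨
    ∑ m V             ≤⟨ ∑-mono V m≤M ⟩
    ∑ (λ _ → M) V     ≡⟨ ∑-const M V ⟩
    length V * M      ∎
    where open ≤-Reasoning

-- Boxes

-- `perimeter` is the elementary symmetric polynomial of degree d - 1 in the sides, the total size
-- of the coordinate projections.
volume perimeter : ∀ {d} → Vec ℕ d → ℕ
volume []       = 1
volume (h ∷ hs) = h * volume hs
perimeter []       = 0
perimeter (h ∷ hs) = volume hs + h * perimeter hs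

box : ∀ {d} → Vec ℕ d → List (ℤ^ d)
box []       = [] ∷ []
box (h ∷ hs) = cartesianProductWith _∷_ (map ℤ.+_ (upTo h)) (box hs)

∷-∈-box : ∀ {d t h x} {hs : Vec ℕ d} → t < h → x ∈ box hs → (ℤ.+ t ∷ x) ∈ box (h ∷ hs)
∷-∈-box t<h x∈ = ∈-cartesianProductWith⁺ _∷_ (∈-map⁺ ℤ.+_ (∈-upTo⁺ t<h)) x∈

box! : ∀ {d} (hs : Vec ℕ d) → Unique (box hs)
box! []       = [] ∷ []
box! (h ∷ hs) = Unique.cartesianProductWith⁺ _∷_ (λ { refl → refl , refl })
  (Unique.map⁺ ℤ.+-injective (Unique.upTo⁺ h)) (box! hs)

∑-box : ∀ {d} (f : ℤ^ (suc d) → ℕ) h (hs : Vec ℕ d) →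
  ∑ f (box (h ∷ hs)) ≡ ∑ (λ t → ∑ (λ x → f (ℤ.+ t ∷ x)) (box hs)) (upTo h)
∑-box f h hs = trans (∑-cartesianProductWith f _∷_ (map ℤ.+_ (upTo h)) (box hs))
  (∑-map (λ t → ∑ (λ x → f (t ∷ x)) (box hs)) ℤ.+_ (upTo h))

length-box : ∀ {d} (hs : Vec ℕ d) → length (box hs) ≡ volume hs
length-box []       = refl
length-box (h ∷ hs) = begin
  length (box (h ∷ hs))                            ≡⟨ ∑-one (box (h ∷ hs)) ⟨
  ∑ (λ _ → 1) (box (h ∷ hs))                       ≡⟨ ∑-box (λ _ → 1) h hs ⟩
  ∑ (λ _ → ∑ (λ _ → 1) (box hs)) (upTo h)          ≡⟨ ∑-const _ (upTo h) ⟩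
  length (upTo h) * ∑ (λ _ → 1) (box hs)           ≡⟨ cong₂ _*_ (length-upTo h) (trans (∑-one (box hs)) (length-box hs)) ⟩
  h * volume hs                                    ∎
  where open ≡-Reasoning

last-levels : ∀ c h → ∑ (λ t → 𝟙 (¬? (c + t <? h))) (upTo h) ≤ c
last-levels c h = begin
  ∑ (λ t → 𝟙 (¬? (c + t <? h))) (upTo h)         ≡⟨ length-filter-𝟙 last? (upTo h) ⟨
  length (filter last? (upTo h))                 ≤⟨ length-injection (λ t → c + t ∸ h) {ys = upTo c}
    (Unique.filter⁺ last? (Unique.upTo⁺ h))
    (λ x∈ y∈ eq → +-cancelˡ-≡ c _ _ (∸-cancelʳ-≡ (beyond x∈) (beyond y∈) eq)) into ⟩
  length (upTo c)                                ≡⟨ length-upTo c ⟩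
  c                                              ∎
  where
  open ≤-Reasoning
  last? : Decidable (λ t → ¬ (c + t < h))
  last? t = ¬? (c + t <? h)
  beyond : ∀ {t} → t ∈ filter last? (upTo h) → h ≤ c + t
  beyond t∈ = ≮⇒≥ (proj₂ (∈-filter⁻ last? {xs = upTo h} t∈))
  into : ∀ {t} → t ∈ filter last? (upTo h) → c + t ∸ h ∈ upTo c
  into {t} t∈ = ∈-upTo⁺ (begin-strict
    c + t ∸ h    <⟨ ∸-monoˡ-< (+-monoʳ-< c (∈-upTo⁻ (proj₁ (∈-filter⁻ last? {xs = upTo h} t∈)))) (beyond t∈) ⟩
    c + h ∸ h    ≡⟨ m+n∸n≡m c h ⟩
    c            ∎)

-- The vector `z` is zero in whatever form it arises from `e zero` or its double. Only points in the
-- last `c` levels can leave the box.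
out-box-first : ∀ {d} c (z : ℤ^ d) → (∀ x → x ⊹ z ≡ x) → ∀ h (hs : Vec ℕ d) →
  out (box (h ∷ hs)) (ℤ.+ c ∷ z) ≤ c * volume hs
out-box-first c z x⊹z≡x h hs = begin
  out (box (h ∷ hs)) (ℤ.+ c ∷ z)
    ≡⟨ ∑-box (𝟙 ∘ exits? (box (h ∷ hs)) (ℤ.+ c ∷ z)) h hs ⟩
  ∑ (λ t → ∑ (λ x → 𝟙 (exits? (box (h ∷ hs)) (ℤ.+ c ∷ z) (ℤ.+ t ∷ x))) (box hs)) (upTo h)
    ≤⟨ ∑-mono (upTo h) (λ {t} _ → ∑-mono (box hs) (λ {x} x∈ →
         𝟙-mono (exits? (box (h ∷ hs)) (ℤ.+ c ∷ z) (ℤ.+ t ∷ x)) (¬? (c + t <? h)) (exit t x∈))) ⟩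
  ∑ (λ t → ∑ (λ _ → 𝟙 (¬? (c + t <? h))) (box hs)) (upTo h)
    ≡⟨ ∑-swap (λ t _ → 𝟙 (¬? (c + t <? h))) (upTo h) (box hs) ⟩
  ∑ (λ _ → ∑ (λ t → 𝟙 (¬? (c + t <? h))) (upTo h)) (box hs)
    ≤⟨ ∑-mono (box hs) (λ _ → last-levels c h) ⟩
  ∑ (λ _ → c) (box hs)                  ≡⟨ ∑-const c (box hs) ⟩
  length (box hs) * c                   ≡⟨ cong (_* c) (length-box hs) ⟩
  volume hs * c                         ≡⟨ *-comm (volume hs) c ⟩
  c * volume hs                         ∎
  where
  open ≤-Reasoning
  exit : ∀ t {x} → x ∈ box hs → (ℤ.+ (t + c) ∷ x ⊹ z) ∉ box (h ∷ hs) → ¬ (c + t < h)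
  exit t {x} x∈ ∉box c+t<h = ∉box (∷-∈-box {hs = hs} (subst (_< h) (+-comm c t) c+t<h) (subst (_∈ box hs) (sym (x⊹z≡x x)) x∈))

out-box-rest : ∀ {d} h (hs : Vec ℕ d) i → out (box (h ∷ hs)) (e (suc i)) ≤ h * out (box hs) (e i)
out-box-rest h hs i = begin
  out (box (h ∷ hs)) (e (suc i))
    ≡⟨ ∑-box (𝟙 ∘ exits? (box (h ∷ hs)) (e (suc i))) h hs ⟩
  ∑ (λ t → ∑ (λ x → 𝟙 (exits? (box (h ∷ hs)) (e (suc i)) (ℤ.+ t ∷ x))) (box hs)) (upTo h)
    ≤⟨ ∑-mono (upTo h) (λ {t} t∈ → ∑-mono (box hs) (λ {x} _ →
         𝟙-mono (exits? (box (h ∷ hs)) (e (suc i)) (ℤ.+ t ∷ x)) (exits? (box hs) (e i) x) (exit (∈-upTo⁻ t∈)))) ⟩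
  ∑ (λ _ → out (box hs) (e i)) (upTo h)      ≡⟨ ∑-const _ (upTo h) ⟩
  length (upTo h) * out (box hs) (e i)       ≡⟨ cong (_* out (box hs) (e i)) (length-upTo h) ⟩
  h * out (box hs) (e i)                     ∎
  where
  open ≤-Reasoning
  exit : ∀ {t x} → t < h → (ℤ.+ (t + 0) ∷ x ⊹ e i) ∉ box (h ∷ hs) → (x ⊹ e i) ∉ box hs
  exit {t} t<h ∉box x+e∈ = ∉box (∷-∈-box {hs = hs} (subst (_< h) (sym (+-identityʳ t)) t<h) x+e∈)

∑-tabulate-suc : ∀ {n} (f : Fin (suc n) → ℕ) → ∑ f (tabulate suc) ≡ ∑ (f ∘ suc) (allFin n)
∑-tabulate-suc {n} f = trans (cong (∑ f) (sym (map-tabulate (λ i → i) suc))) (∑-map f suc (allFin n))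

out-box : ∀ {d} (hs : Vec ℕ d) → ∑ (out (box hs) ∘ e) (allFin d) ≤ perimeter hs
out-box []       = z≤n
out-box (h ∷ hs) = +-mono-≤
  (≤-trans (out-box-first 1 _ ⊹-0 h hs) (≤-reflexive (*-identityˡ (volume hs))))
  (begin
    ∑ (out (box (h ∷ hs)) ∘ e) (tabulate suc)           ≡⟨ ∑-tabulate-suc (out (box (h ∷ hs)) ∘ e) ⟩
    ∑ (λ i → out (box (h ∷ hs)) (e (suc i))) (allFin _) ≤⟨ ∑-mono (allFin _) (λ {i} _ → out-box-rest h hs i) ⟩
    ∑ (λ i → h * out (box hs) (e i)) (allFin _)         ≡⟨ *-∑ h (out (box hs) ∘ e) (allFin _) ⟨
    h * ∑ (out (box hs) ∘ e) (allFin _)                 ≤⟨ *-monoʳ-≤ h (out-box hs) ⟩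
    h * perimeter hs                                    ∎)
  where open ≤-Reasoning

halfCost-box : ∀ {D} (2≤d : 2 ≤ suc D) w (hs : Vec ℕ D) →
  halfCost 2≤d (box (w ∷ hs)) ≤ 3 * volume hs + w * perimeter hs
halfCost-box {D} 2≤d@(s≤s _) w hs = begin
  halfCost 2≤d (box (w ∷ hs))
    ≤⟨ +-mono-≤ (out-box-first 2 _ fixed w hs)
        (≤-trans (≤-reflexive (∑-map (out (box (w ∷ hs))) e (allFin (suc D)))) (out-box (w ∷ hs))) ⟩
  2 * volume hs + (volume hs + w * perimeter hs)  ≡⟨ eq (volume hs) (w * perimeter hs) ⟩
  3 * volume hs + w * perimeter hs                ∎
  where
  open ≤-Reasoning
  eq : ∀ v p → 2 * v + (v + p) ≡ 3 * v + p
  eq = solve-∀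
  fixed : ∀ x → x ⊹ ℤ.+ 2 · replicate D 0ℤ ≡ x
  fixed x = trans (cong (x ⊹_) (map-replicate (λ z → ℤ.+ 2 ℤ.* z) 0ℤ D)) (⊹-0 x)

volume-cube : ∀ a D → volume (replicate D a) ≡ a ^ D
volume-cube a zero    = refl
volume-cube a (suc D) = cong (a *_) (volume-cube a D)

perimeter-cube : ∀ a D → perimeter (replicate D a) ≡ dpow a D
perimeter-cube a zero    = refl
perimeter-cube a (suc D) = cong₂ _+_ (volume-cube a D) (cong (a *_) (perimeter-cube a D))

-- Two incompatible sizes

module Sizes (A₀ ε : ℕ) (4+ε≤A₀ : 4 + ε ≤ A₀) where
  open Tangent A₀

  D q δ : ℕ
  D = suc ε
  q = A ^ ε
  δ = dpow A ε

  -- Volumes of `box₁` and `box₂` and upper bounds for their half-costs. Here ε = d - 2, and `q` and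
  -- `δ` are the volume and perimeter of the ε-dimensional cube of side A.
  n₁ n₂ C₁ C₂ : ℕ
  n₁ = (3 * A + 2) * (A * q)
  n₂ = (3 * A + 1) * (B * q)
  C₁ = 3 * (A * q) + (3 * A + 2) * (q + A * δ)
  C₂ = 3 * (B * q) + (3 * A + 1) * (q + B * δ)

  instance
    q≢0 : NonZero q
    q≢0 = m^n≢0 A ε

    Aq≢0 : NonZero (A * q)
    Aq≢0 = m*n≢0 A q

    Bq≢0 : NonZero (B * q)
    Bq≢0 = m*n≢0 B q

  Aδ≡εq : ∀ n → A * dpow A n ≡ n * A ^ n
  Aδ≡εq zero    = *-zeroʳ A
  Aδ≡εq (suc n) rewrite dpow-value A n = eq A (suc n) (A ^ n)
    where
    eq : ∀ a n x → a * (n * x) ≡ n * (a * x)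
    eq = solve-∀

  q+Aδ≤ : q + A * δ ≤ A * q
  q+Aδ≤ = begin
    q + A * δ    ≡⟨ cong (q +_) (Aδ≡εq ε) ⟩
    D * q        ≤⟨ *-monoˡ-≤ q (s≤s (≤-trans (m≤n+m ε 4) 4+ε≤A₀)) ⟩
    A * q        ∎
    where open ≤-Reasoning

  δ≤q : δ ≤ q
  δ≤q = *-cancelˡ-≤ A (≤-trans (m≤n+m (A * δ) q) q+Aδ≤)

  q+Bδ≤ : q + B * δ ≤ B * q
  q+Bδ≤ = begin
    q + B * δ       ≡⟨ eq q A δ ⟩
    δ + (q + A * δ) ≤⟨ +-mono-≤ δ≤q q+Aδ≤ ⟩
    B * q           ∎
    where
    open ≤-Reasoning
    eq : ∀ q A δ → q + suc A * δ ≡ δ + (q + A * δ)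
    eq = solve-∀

  private
    shifted : ∃[ z ] A ≡ 5 + z
    shifted with z , refl ← m≤n⇒∃[o]m+o≡n (≤-trans (m≤m+n 4 ε) 4+ε≤A₀) = z , refl

  -- Twice M + Π ≤ n₁, with 2 M replaced by its bound `C₁`. Writing A = 5 + z leaves the slack (z +
  -- 2) A q.
  room₁ : C₁ + 2 * Π D 1 ≤ 2 * n₁
  room₁ with z , A≡ ← shifted = begin
    C₁ + 2 * Π D 1    ≤⟨ +-monoˡ-≤ (2 * Π D 1) (+-monoʳ-≤ (3 * (A * q)) (*-monoʳ-≤ (3 * A + 2) q+Aδ≤)) ⟩
    3 * (A * q) + (3 * A + 2) * (A * q) + 2 * (A * q * (B * 1)) ≤⟨ bound A q z A≡ ⟩
    2 * n₁            ∎
    where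
    open ≤-Reasoning
    eq : ∀ z q → 3 * ((5 + z) * q) + (3 * (5 + z) + 2) * ((5 + z) * q) + 2 * ((5 + z) * q * ((6 + z) * 1))
         + (z + 2) * ((5 + z) * q) ≡ 2 * ((3 * (5 + z) + 2) * ((5 + z) * q))
    eq = solve-∀
    bound : ∀ A q z → A ≡ 5 + z → 3 * (A * q) + (3 * A + 2) * (A * q) + 2 * (A * q * (suc A * 1))
      ≤ 2 * ((3 * A + 2) * (A * q))
    bound _ q z refl = ≤-trans (m≤m+n _ ((z + 2) * ((5 + z) * q))) (≤-reflexive (eq z q))

  -- The bound on `P` covers both products, A B q and B² q. Strictness is what later excludes lines
  -- with a single point.
  room₂ : ∀ {P} → P ≤ q * (B * B) → C₂ + 2 * P < 2 * n₂
  room₂ {P} P≤ with z , A≡ ← shifted = begin-strict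
    C₂ + 2 * P    ≤⟨ +-mono-≤ (+-monoʳ-≤ (3 * (B * q)) (*-monoʳ-≤ (3 * A + 1) q+Bδ≤)) (*-monoʳ-≤ 2 P≤) ⟩
    3 * (B * q) + (3 * A + 1) * (B * q) + 2 * (q * (B * B)) <⟨ bound A q z A≡ ⟩
    2 * n₂        ∎
    where
    open ≤-Reasoning
    eq : ∀ z q → 3 * ((6 + z) * q) + (3 * (5 + z) + 1) * ((6 + z) * q) + 2 * (q * ((6 + z) * (6 + z)))
         + suc z * ((6 + z) * q) ≡ 2 * ((3 * (5 + z) + 1) * ((6 + z) * q))
    eq = solve-∀
    bound : ∀ A q z .{{_ : NonZero q}} → A ≡ 5 + z → 3 * (suc A * q) + (3 * A + 1) * (suc A * q) + 2 * (q * (suc A * suc A))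
      < 2 * ((3 * A + 1) * (suc A * q))
    bound _ q z refl = <-≤-trans (m<m+n _ (*-mono-≤ {1} {suc z} {1} {(6 + z) * q} (s≤s z≤n) (*-mono-≤ {1} {6 + z} (s≤s z≤n) (>-nonZero⁻¹ q))))
      (≤-reflexive (eq z q))

  module _ {h V} (L : Layers D n₁ h V) (h≤C₁ : h ≤ C₁) where
    open Energy L A₀ D 1 (+-comm D 1)

    private
      M+Π≤n₁ : M + Π D 1 ≤ n₁
      M+Π≤n₁ = *-cancelˡ-≤ 2 (begin
        2 * (M + Π D 1)       ≡⟨ *-distribˡ-+ 2 M (Π D 1) ⟩
        2 * M + 2 * Π D 1     ≤⟨ +-monoˡ-≤ (2 * Π D 1) (≤-trans 2M≤h h≤C₁) ⟩
        C₁ + 2 * Π D 1        ≤⟨ room₁ ⟩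
        2 * n₁                ∎)
        where open ≤-Reasoning

      -- Here 3 Π - n₁ = A q and C₁ Π - n₁ E = (A q)², so `energy-M` reads A q M ≤ (A q)².
      M≤Aq : M ≤ A * q
      M≤Aq = *-cancelˡ-≤ (A * q) (+-cancelˡ-≤ (n₁ * E D 1 + n₁ * M) _ _ (begin
        n₁ * E D 1 + n₁ * M + A * q * M       ≡⟨ eq₁ A q (n₁ * E D 1) M ⟩
        n₁ * E D 1 + 3 * (Π D 1 * M)          ≤⟨ energy-M M+Π≤n₁ ⟩
        h * Π D 1 + n₁ * M                    ≤⟨ +-monoˡ-≤ (n₁ * M) (*-monoˡ-≤ (Π D 1) h≤C₁) ⟩
        C₁ * Π D 1 + n₁ * M                   ≡⟨ eq₂ A q δ (n₁ * M) ⟩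
        n₁ * E D 1 + n₁ * M + A * q * (A * q) ∎))
        where
        open ≤-Reasoning
        eq₁ : ∀ A q x M → x + (3 * A + 2) * (A * q) * M + A * q * M ≡ x + 3 * (A * q * (suc A * 1) * M)
        eq₁ = solve-∀
        eq₂ : ∀ A q δ y → (3 * (A * q) + (3 * A + 2) * (q + A * δ)) * (A * q * (suc A * 1)) + y
          ≡ (3 * A + 2) * (A * q) * ((q + A * δ) * (suc A * 1) + A * q * (1 + suc A * 0)) + y + A * q * (A * q)
        eq₂ = solve-∀

    many-layers : 3 * A + 2 ≤ length V
    many-layers = *-cancelʳ-≤ _ _ (A * q) (≤-trans n≤∣V∣*M (*-monoʳ-≤ (length V) M≤Aq))

  module _ {h V} (L : Layers D n₂ h V) (h≤C₂ : h ≤ C₂) where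
    private
      module E₁ = Energy L A₀ D 1 (+-comm D 1)
      module E₂ = Energy L A₀ ε 2 (+-comm ε 2)
      open E₁ using (M; ∑sq; 2M≤h; ∑sq≤; m≤M)
      open Layers L

      room : ∀ {P} → P ≤ q * (B * B) → M + P < n₂
      room {P} P≤ = *-cancelˡ-< 2 _ _ (begin-strict
        2 * (M + P)       ≡⟨ *-distribˡ-+ 2 M P ⟩
        2 * M + 2 * P     ≤⟨ +-monoˡ-≤ (2 * P) (≤-trans 2M≤h h≤C₂) ⟩
        C₂ + 2 * P        <⟨ room₂ P≤ ⟩
        2 * n₂            ∎)
        where open ≤-Reasoning

      M+Π₁<n₂ : M + Π D 1 < n₂
      M+Π₁<n₂ = room (≤-trans (≤-reflexive (eq A q B)) (*-monoʳ-≤ q (*-monoˡ-≤ B (n≤1+n A))))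
        where
        eq : ∀ A q B → A * q * (B * 1) ≡ q * (A * B)
        eq = solve-∀

      M+Π₂≤n₂ : M + Π ε 2 ≤ n₂
      M+Π₂≤n₂ = <⇒≤ (room (≤-reflexive (cong (λ z → q * (B * z)) (*-identityʳ B))))

      C₂Π : ∀ A q δ → (3 * (suc A * q) + (3 * A + 1) * (q + suc A * δ)) * (A * q * (suc A * 1)) + suc A * q * (suc A * q)
        ≡ (3 * A + 1) * (suc A * q) * ((q + A * δ) * (suc A * 1) + A * q * (1 + suc A * 0))
      C₂Π = solve-∀

      3ΠM : ∀ A q M → 3 * (A * q * (suc A * 1) * M) + suc A * q * M ≡ (3 * A + 1) * (suc A * q) * M
      3ΠM = solve-∀

      -- For the sides (A^D , B) the sign is reversed: n₂ - 3 Π = B q and n₂ E - C₂ Π = (B q)².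
      Bq≤M : B * q ≤ M
      Bq≤M = *-cancelˡ-≤ (B * q) (+-cancelˡ-≤ (C₂ * Π D 1 + 3 * (Π D 1 * M)) _ _ (begin
        C₂ * Π D 1 + 3 * (Π D 1 * M) + B * q * (B * q)   ≡⟨ eq (C₂ * Π D 1) _ (B * q * (B * q)) ⟩
        C₂ * Π D 1 + B * q * (B * q) + 3 * (Π D 1 * M)   ≡⟨ cong (_+ 3 * (Π D 1 * M)) (C₂Π A q δ) ⟩
        n₂ * E D 1 + 3 * (Π D 1 * M)                     ≤⟨ E₁.energy-M (<⇒≤ M+Π₁<n₂) ⟩
        h * Π D 1 + n₂ * M                               ≤⟨ +-monoˡ-≤ (n₂ * M) (*-monoˡ-≤ (Π D 1) h≤C₂) ⟩
        C₂ * Π D 1 + n₂ * M                              ≡⟨ cong (C₂ * Π D 1 +_) (3ΠM A q M) ⟨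
        C₂ * Π D 1 + (3 * (Π D 1 * M) + B * q * M)       ≡⟨ +-assoc (C₂ * Π D 1) _ _ ⟨
        C₂ * Π D 1 + 3 * (Π D 1 * M) + B * q * M         ∎))
        where
        open ≤-Reasoning
        eq : ∀ x y z → x + y + z ≡ x + z + y
        eq = solve-∀

      -- For the sides (A^ε , B , B) one has 3 Π - n₂ = 2 B q and C₂ Π - n₂ E = 2 (B q)², which
      -- gives the opposite bound.
      M≤Bq : M ≤ B * q
      M≤Bq = *-cancelˡ-≤ (2 * (B * q)) {{m*n≢0 2 (B * q)}} (+-cancelˡ-≤ (n₂ * E ε 2 + n₂ * M) _ _ (begin
        n₂ * E ε 2 + n₂ * M + 2 * (B * q) * M          ≡⟨ eq₁ A q (n₂ * E ε 2) M ⟩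
        n₂ * E ε 2 + 3 * (Π ε 2 * M)                   ≤⟨ E₂.energy-M M+Π₂≤n₂ ⟩
        h * Π ε 2 + n₂ * M                             ≤⟨ +-monoˡ-≤ (n₂ * M) (*-monoˡ-≤ (Π ε 2) h≤C₂) ⟩
        C₂ * Π ε 2 + n₂ * M                            ≡⟨ eq₂ A q δ (n₂ * M) ⟩
        n₂ * E ε 2 + n₂ * M + 2 * (B * q) * (B * q)    ∎))
        where
        open ≤-Reasoning
        eq₁ : ∀ A q x M → x + (3 * A + 1) * (suc A * q) * M + 2 * (suc A * q) * M
                        ≡ x + 3 * (q * (suc A * (suc A * 1)) * M)
        eq₁ = solve-∀
        eq₂ : ∀ A q δ y → (3 * (suc A * q) + (3 * A + 1) * (q + suc A * δ)) * (q * (suc A * (suc A * 1))) + y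
          ≡ (3 * A + 1) * (suc A * q) * (δ * (suc A * (suc A * 1)) + q * (suc A * 1 + suc A * (1 + suc A * 0))) + y
            + 2 * (suc A * q) * (suc A * q)
        eq₂ = solve-∀

      M≡Bq : M ≡ B * q
      M≡Bq = ≤-antisym M≤Bq Bq≤M

      -- At M = B q the energy inequality leaves no other slack. Since every layer has at most `M`
      -- points, for k = 0 this forces all layers to be full.
      n₂M≤ : n₂ * M ≤ k * Π D 1 + ∑sq
      n₂M≤ = +-cancelˡ-≤ (C₂ * Π D 1) _ _ (begin
        C₂ * Π D 1 + n₂ * M                               ≡⟨ cong (C₂ * Π D 1 +_) (3ΠM A q M) ⟨
        C₂ * Π D 1 + (3 * (Π D 1 * M) + B * q * M)        ≡⟨ cong (λ z → C₂ * Π D 1 + (3 * (Π D 1 * M) + B * q * z)) M≡Bq ⟩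
        C₂ * Π D 1 + (3 * (Π D 1 * M) + B * q * (B * q))  ≡⟨ eq (C₂ * Π D 1) _ (B * q * (B * q)) ⟩
        C₂ * Π D 1 + B * q * (B * q) + 3 * (Π D 1 * M)    ≡⟨ cong (_+ 3 * (Π D 1 * M)) (C₂Π A q δ) ⟩
        n₂ * E D 1 + 3 * (Π D 1 * M)                      ≤⟨ E₁.energy ⟩
        h * Π D 1 + k * Π D 1 + ∑sq                       ≤⟨ +-monoˡ-≤ ∑sq (+-monoˡ-≤ (k * Π D 1) (*-monoˡ-≤ (Π D 1) h≤C₂)) ⟩
        C₂ * Π D 1 + k * Π D 1 + ∑sq                      ≡⟨ +-assoc (C₂ * Π D 1) _ _ ⟩
        C₂ * Π D 1 + (k * Π D 1 + ∑sq)                    ∎)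
        where
        open ≤-Reasoning
        eq : ∀ x y z → x + (y + z) ≡ x + z + y
        eq = solve-∀

      -- Inserting `∑sq≤` into `n₂M≤` cancels n₂ r. As M + Π < n₂ strictly, only k = 0 remains
      -- possible.
      n₂k≤ : n₂ * k ≤ (M + Π D 1) * k
      n₂k≤ = +-cancelˡ-≤ (n₂ * r) _ _ (begin
        n₂ * r + n₂ * k                   ≡⟨ *-distribˡ-+ n₂ r k ⟨
        n₂ * M                            ≤⟨ ≤-trans n₂M≤ (+-monoʳ-≤ (k * Π D 1) ∑sq≤) ⟩
        k * Π D 1 + (n₂ * r + M * k)      ≡⟨ eq k (Π D 1) (n₂ * r) M ⟩
        n₂ * r + (M + Π D 1) * k          ∎)
        where
        open ≤-Reasoning
        eq : ∀ k p x M → k * p + (x + M * k) ≡ x + (M + p) * k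
        eq = solve-∀

      k≡0 : k ≡ 0
      k≡0 = vanishes k n₂k≤
        where
        vanishes : ∀ k → n₂ * k ≤ (M + Π D 1) * k → k ≡ 0
        vanishes zero      _  = refl
        vanishes k@(suc _) le = contradiction M+Π₁<n₂ (≤⇒≯ (*-cancelʳ-≤ n₂ (M + Π D 1) k le))

      -- The sum of (m t - 1)(M - m t) ≥ 0 over the layers, all inhabited. Together with n₂ M ≤ ∑sq
      -- it gives |V| M ≤ n₂ = (3 A + 1) M.
      ∑sq+∣V∣M≤ : ∑sq + length V * M ≤ n₂ * M + n₂
      ∑sq+∣V∣M≤ = begin
        ∑sq + length V * M                   ≡⟨ cong (∑sq +_) (∑-const M V) ⟨
        ∑sq + ∑ (λ _ → M) V                  ≡⟨ ∑-+ (sq ∘ m) (λ _ → M) V ⟨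
        ∑ (λ t → sq (m t) + M) V             ≤⟨ ∑-mono V (λ {t} t∈ → term (inhabited t∈) (m≤M t∈)) ⟩
        ∑ (λ t → M * m t + m t) V            ≡⟨ ∑-+ (λ t → M * m t) m V ⟩
        ∑ (λ t → M * m t) V + ∑ m V          ≡⟨ cong (_+ ∑ m V) (*-∑ M m V) ⟨
        M * ∑ m V + ∑ m V                    ≡⟨ cong (λ n → M * n + n) total ⟩
        M * n₂ + n₂                          ≡⟨ cong (_+ n₂) (*-comm M n₂) ⟩
        n₂ * M + n₂                          ∎
        where
        open ≤-Reasoning
        eq₁ : ∀ x M → x * x + M ≡ 1 * M + x * x
        eq₁ = solve-∀
        eq₂ : ∀ x M → 1 * x + x * M ≡ M * x + x
        eq₂ = solve-∀
        term : ∀ {x M} → 1 ≤ x → x ≤ M → sq x + M ≤ M * x + x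
        term {x} {M} 1≤x x≤M = ≤-trans (≤-reflexive (eq₁ x M))
          (≤-trans (rearrangement 1≤x x≤M) (≤-reflexive (eq₂ x M)))

    few-layers : length V ≤ 3 * A + 1
    few-layers = *-cancelʳ-≤ _ _ (B * q) (+-cancelˡ-≤ (n₂ * M) _ _ (begin
      n₂ * M + length V * (B * q)          ≤⟨ +-monoˡ-≤ _ (subst (λ k → n₂ * M ≤ k * Π D 1 + ∑sq) k≡0 n₂M≤) ⟩
      ∑sq + length V * (B * q)             ≡⟨ cong (λ z → ∑sq + length V * z) M≡Bq ⟨
      ∑sq + length V * M                   ≤⟨ ∑sq+∣V∣M≤ ⟩
      n₂ * M + n₂                          ∎))
      where open ≤-Reasoning

  A₀≤n₁ : A₀ ≤ n₁
  A₀≤n₁ = ≤-trans (n≤1+n A₀) (≤-trans (m≤m*n A q) (m≤n*m (A * q) (3 * A + 2) {{>-nonZero (≤-trans (s≤s z≤n) (m≤n+m 2 (3 * A)))}}))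

  n₁≤n₂ : n₁ ≤ n₂
  n₁≤n₂ = ≤-trans (m≤m+n n₁ (2 * (A * q) + q)) (≤-reflexive (eq A q))
    where
    eq : ∀ A q → (3 * A + 2) * (A * q) + (2 * (A * q) + q) ≡ (3 * A + 1) * (suc A * q)
    eq = solve-∀

  box₁ box₂ : List (ℤ^ (suc D))
  box₁ = box (3 * A + 2 ∷ replicate D A)
  box₂ = box (3 * A + 1 ∷ B ∷ replicate ε A)

  box₁-size : HasSize n₁ box₁
  box₁-size = box! (3 * A + 2 ∷ replicate D A) , trans (length-box (3 * A + 2 ∷ replicate D A)) (cong ((3 * A + 2) *_) (volume-cube A D))

  box₂-size : HasSize n₂ box₂
  box₂-size = box! (3 * A + 1 ∷ B ∷ replicate ε A) , trans (length-box (3 * A + 1 ∷ B ∷ replicate ε A))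
    (cong (λ v → (3 * A + 1) * (B * v)) (volume-cube A ε))

  box₁-cost : ∀ 2≤d → halfCost 2≤d box₁ ≤ C₁
  box₁-cost 2≤d = ≤-trans (halfCost-box 2≤d (3 * A + 2) (replicate D A))
    (≤-reflexive (cong₂ (λ v p → 3 * v + (3 * A + 2) * p) (volume-cube A D) (perimeter-cube A D)))

  box₂-cost : ∀ 2≤d → halfCost 2≤d box₂ ≤ C₂
  box₂-cost 2≤d = ≤-trans (halfCost-box 2≤d (3 * A + 1) (B ∷ replicate ε A))
    (≤-reflexive (cong₂ (λ v p → 3 * (B * v) + (3 * A + 1) * (v + B * p)) (volume-cube A ε) (perimeter-cube A ε)))

-- Nested optimal sets and the contradiction

halfCost-optimal : ∀ {d} (2≤d : 2 ≤ d) {n} {S T : List (ℤ^ d)} → Cayley.IsOptimal (generators 2≤d) n S → HasSize n T →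
  halfCost 2≤d S ≤ halfCost 2≤d T
halfCost-optimal 2≤d {T = T} ((S! , _) , optimal) T-size@(T! , _) =
  *-cancelˡ-≤ 2 (subst₂ _≤_ (∂≡2*halfCost 2≤d S!) (∂≡2*halfCost 2≤d T!) (optimal T T-size))

levels-⊆ : ∀ {d} (i : Fin d) {S T} → S ⊆ T → levels i S ⊆ levels i T
levels-⊆ i {S} S⊆T t∈ with x , x∈S , refl ← Levels.∈-image⁻ i S t∈ = Levels.∈-image⁺ i (S⊆T x∈S)

chain-⊆ : ∀ {X : Set} (S : ℕ → List X) n → (∀ i → n ≤ i → S i ⊆ S (suc i)) → ∀ {i j} → n ≤ i → i ≤ j → S i ⊆ S j
chain-⊆ S n step {i} n≤i i≤j = go (≤⇒≤′ i≤j)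
  where
  go : ∀ {j} → i ≤′ j → S i ⊆ S j
  go ≤′-refl        x∈ = x∈
  go (≤′-step i≤′j) x∈ = step _ (≤-trans n≤i (≤′⇒≤ i≤′j)) (go i≤′j x∈)

theorem1 : ∀ (d : ℕ) (2≤d : 2 ≤ d) → let open Cayley (generators 2≤d) in
    ∀ (n : ℕ) (Sₙ : List (ℤ^ d)) → IsOptimal n Sₙ → ¬ NestedSolutionsFrom n Sₙ
theorem1 (suc (suc ε)) 2≤d@(s≤s (s≤s _)) n Sₙ _ (S , _ , nested , optimal) =
  n≮n (3 * A + 1) (begin
    suc (3 * A + 1)              ≡⟨ +-suc (3 * A) 1 ⟨
    3 * A + 2                    ≤⟨ many-layers (layersAt n₁ n≤n₁) (costAt n≤n₁ box₁-size (box₁-cost 2≤d)) ⟩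
    length (levels zero (S n₁))  ≤⟨ length-⊆ (Levels.image! zero (S n₁))
                                      (levels-⊆ zero (chain-⊆ S n nested n≤n₁ n₁≤n₂)) ⟩
    length (levels zero (S n₂))  ≤⟨ few-layers (layersAt n₂ n≤n₂) (costAt n≤n₂ box₂-size (box₂-cost 2≤d)) ⟩
    3 * A + 1                    ∎)
  where
  open ≤-Reasoning
  -- The value 4 + ε + n for A₀ meets the largeness condition 4 + ε ≤ A₀ and, since A₀ ≤ n₁ ≤ n₂,
  -- puts both sizes at or beyond the start `n` of the chain.
  open Sizes (4 + ε + n) ε (m≤m+n (4 + ε) n)
  open Tangent (4 + ε + n) using (A)
  n≤n₁ : n ≤ n₁
  n≤n₁ = ≤-trans (m≤n+m n (4 + ε)) A₀≤n₁
  n≤n₂ : n ≤ n₂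
  n≤n₂ = ≤-trans n≤n₁ n₁≤n₂
  layersAt : ∀ i → n ≤ i → Layers D i (halfCost 2≤d (S i)) (levels zero (S i))
  layersAt i n≤i with (S! , size) , _ ← optimal i n≤i =
    subst (λ i′ → Layers D i′ (halfCost 2≤d (S i)) (levels zero (S i))) size (layers (S i) S! 2≤d)
  costAt : ∀ {i T C} → n ≤ i → HasSize i T → halfCost 2≤d T ≤ C → halfCost 2≤d (S i) ≤ C
  costAt {i} {T} n≤i T-size T≤ = ≤-trans (halfCost-optimal 2≤d {S = S i} {T} (optimal i n≤i) T-size) T≤
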